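{- Let $A$ be a commutative ring, let $n\ge 1$, and let $T=(t_{ij})$ be an $n\times n$ skew symmetric matrix with entries in $A$ and with zeros on the diagonal (that is, $t_{ji}=-t_{ij}$ and $t_{ii}=0$ for all $i,j$). Let $R$ and $S$ be subsets (not necessarily disjoint) of $\{1,\ldots,n\}$ of the same cardinality $m$, with elements $r_1<\cdots<r_m$ and $s_1<\cdots<s_m$, respectively. Set $\rho=r_1\ldots r_m$ and $\sigma=s_1\ldots s_m$, regarded as words in the letters $1,\ldots,n$. Then $$\det(T[R;S]) = (-1)^{\left\lfloor \frac{m}{2}\right\rfloor}\sum_{k=0}^{\left\lfloor \frac{m}{2}\right\rfloor}(-1)^k\sum_{\substack{|\omega|=2k\\ \omega\subseteq\rho}}\operatorname{sgn}\begin{pmatrix}\rho\\ \omega(\rho\setminus\omega)\end{pmatrix}\,\mathcal{P}[\omega]\,\mathcal{P}[(\rho\setminus\omega)\sigma],$$ where the inner sum is over all subwords $\omega$ of $\rho$ of length $2k$.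
   Context: For subsets $R,S\subseteq\{1,\ldots,n\}$, $T[R;S]$ denotes the submatrix of $T$ obtained by taking the rows indexed by $R$ and the columns indexed by $S$ (in increasing order). Words: a word is a finite sequence of letters from $\{1,\ldots,n\}$; $|\omega|$ denotes the length of $\omega$, and juxtaposition of words denotes concatenation. For a word $\rho$ with distinct letters, $\omega\subseteq\rho$ means that $\omega$ is a subword of $\rho$, i.e. obtained from $\rho$ by deleting some (possibly none or all) letters and keeping the remaining ones in order; $\rho\setminus\omega$ is the word obtained from $\rho$ by deleting the letters of $\omega$. If $\alpha$ and $\beta$ are words without repeated letters that have the same letters, $\operatorname{sgn}\begin{pmatrix}\alpha\\ \beta\end{pmatrix}\in\{1,-1\}$ is the sign of the permutation that rearranges $\alpha$ into $\beta$. The function $\mathcal{P}$: set $\mathcal{P}[ij]=t_{ij}$ for $i,j\in\{1,\ldots,n\}$ and extend $\mathcal{P}$ to a function from words to $A$ as follows. The value on the empty word is $1$. The value on any word with a repeated letter is $0$. The value on any word of odd length is $0$. For a word $i_1\ldots i_{2k}$ of even length with distinct letters, $$\mathcal{P}[i_1\ldots i_{2k}]=\sum \operatorname{sgn}\begin{pmatrix}i_1\ldots i_{2k}\\ j_1\ldots j_{2k}\end{pmatrix}\,\mathcal{P}[j_1j_2]\cdots\mathcal{P}[j_{2k-1}j_{2k}],$$ where the sum is over all (unordered) partitions $\{\{j_1,j_2\},\ldots,\{j_{2k-1},j_{2k}\}\}$ of the set $\{i_1,\ldots,i_{2k}\}$ into $k$ subsets of cardinality $2$, each partition counted once; the summand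 does not depend on the order of the subsets or on the order of the two elements in each subset. (Thus for $r_1<\cdots<r_m$, $\mathcal{P}[r_1\ldots r_m]$ is the Pfaffian of $T[R;R]$ with $R=\{r_1,\ldots,r_m\}$.) -}

module Defs where

open import Algebra.Bundles using (CommutativeRing)
open import Data.Bool.Base using (true; false; if_then_else_)
open import Data.Fin.Base using (Fin; zero; suc)
open import Data.Fin.Properties using (_≟_)
open import Data.Fin.Subset using (Subset; ∣_∣)
open import Data.List.Base as List using (List; []; _∷_; _++_; map; concatMap; foldr; length; filter)
open import Data.List.Membership.DecPropositional using (_∈?_)
open import Data.List.Relation.Unary.Unique.DecPropositional using (unique?)
open import Data.Nat.Base using (ℕ; zero; suc; _+_)
open import Data.Nat.Properties using (_<?_)
open import Data.Product.Base using (_×_; _,_)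
open import Data.Vec.Base as Vec using (Vec; []; _∷_; lookup; removeAt)
open import Relation.Binary.PropositionalEquality.Core using (_≡_)
open import Relation.Nullary.Decidable.Core using (does; ¬?)

Word : ℕ → Set
Word n = List (Fin n)

-- The elements of a subset in increasing order.
elements : ∀ {n} (R : Subset n) → Vec (Fin n) ∣ R ∣
elements []          = []
elements (true  ∷ R) = zero ∷ Vec.map suc (elements R)
elements (false ∷ R) = Vec.map suc (elements R)

increasing : ∀ {n m} (R : Subset n) → ∣ R ∣ ≡ m → Vec (Fin n) m
increasing R ∣R∣≡m = Vec.cast ∣R∣≡m (elements R)

-- Subwords are taken by choice of positions, so in a word with distinct
-- letters each subword of length l is listed exactly once.
subwords : ∀ {n} → (l : ℕ) → Word n → List (Word n)
subwords zero    _       = [] ∷ []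
subwords (suc l) []      = []
subwords (suc l) (x ∷ w) = map (x ∷_) (subwords l w) ++ subwords (suc l) w

infixl 6 _∖_

_∖_ : ∀ {n} → Word n → Word n → Word n
w ∖ v = filter (λ x → ¬? (_∈?_ _≟_ x v)) w

-- The number of letters before the first occurrence of x.
position : ∀ {n} → Word n → Fin n → ℕ
position []      x = 0
position (y ∷ w) x = if does (x ≟ y) then 0 else suc (position w x)

inversions : List ℕ → ℕ
inversions []       = 0
inversions (a ∷ as) = length (filter (_<? a) as) + inversions as

module _ {a} {X : Set a} where

  -- All rearrangements: choose the entry that comes first, then arrange the
  -- remaining ones.
  permutations : ∀ {k} → Vec X k → List (Vec X k)
  permutations []           = [] ∷ []
  permutations {suc k} xs@(_ ∷ _) = concatMap
    (λ i → map (lookup xs i ∷_) (permutations (removeAt xs i)))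
    (List.allFin (suc k))

  -- All partitions of the entries into two-element subsets. The first entry is
  -- matched with each of the others in turn, so each unordered partition is
  -- listed exactly once; there are none if the number of entries is odd.
  pairings : ∀ {k} → Vec X k → List (List (X × X))
  pairings []       = [] ∷ []
  pairings (_ ∷ []) = []
  pairings {suc (suc k)} (x ∷ xs@(_ ∷ _)) = concatMap
    (λ i → map ((x , lookup xs i) ∷_) (pairings (removeAt xs i)))
    (List.allFin (suc k))

  flatten : List (X × X) → List X
  flatten = concatMap (λ (x , y) → x ∷ y ∷ [])

module Pfaffians {c ℓ} (A : CommutativeRing c ℓ) where

  open CommutativeRing A renaming (_+_ to _⊕_)
  open import Algebra.Properties.Semiring.Exp semiring public using (_^_)

  Matrix : ℕ → ℕ → Set c
  Matrix m n = Fin m → Fin n → Carrier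

  infixr 6 sum-over
  infixr 8 product-over

  sum-over : ∀ {i} {I : Set i} → List I → (I → Carrier) → Carrier
  sum-over xs f = foldr (λ x s → f x ⊕ s) 0# xs

  product-over : ∀ {i} {I : Set i} → List I → (I → Carrier) → Carrier
  product-over xs f = foldr (λ x p → f x * p) 1# xs

  syntax sum-over     xs (λ x → e) = ∑[ x ∈ xs ] e
  syntax product-over xs (λ x → e) = ∏[ x ∈ xs ] e

  -- Meaningful when α and β have the same letters, without repetition: then
  -- map (position α) β is the permutation of 0, 1, … rearranging α into β.
  sgn : ∀ {n} → Word n → Word n → Carrier
  sgn α β = (- 1#) ^ inversions (map (position α) β)

  det : ∀ {m} → Matrix m m → Carrier
  det {m} M =
    ∑[ π ∈ permutations (Vec.allFin m) ]
      (sgn (List.allFin m) (Vec.toList π) * (∏[ i ∈ List.allFin m ] M i (lookup π i)))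

  submatrix : ∀ {n m p} → Matrix n n → Vec (Fin n) m → Vec (Fin n) p → Matrix m p
  submatrix T r s i j = T (lookup r i) (lookup s j)

  𝒫 : ∀ {n} → Matrix n n → Word n → Carrier
  𝒫 T w =
    if does (unique? _≟_ w)
    then ∑[ p ∈ pairings (Vec.fromList w) ] (sgn w (flatten p) * (∏[ q ∈ p ] entry q))
    else 0#
    where
    entry : _ × _ → Carrier
    entry (i , j) = T i j

{-# OPTIONS --safe #-}
module Submission where

-- Write pf for the Pfaffian of a word, expanded along its first letter, and
-- pf⁻ for the Pfaffian belonging to - T; since pf⁻ ω = (-1)ᵏ pf ω for |ω| = 2k
-- and pf⁻ ω = 0 for |ω| odd, the double sum is
--   F ρ σ = Σ ± pf⁻ ω · pf (τ σ),
-- taken over all splittings of ρ into complementary subwords ω and τ. Expand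
-- the terms of F (x ρ) σ along x. The terms pairing x with a letter of ρ come
-- once from pf⁻ and once from pf, with opposite signs, and cancel. The others
-- pair x with a letter y of σ, so
--   F (x ρ) σ = (-1)^|ρ| Σⱼ (-1)ʲ T x σⱼ · F ρ (σ without σⱼ).
-- Up to the sign (-1)^⌊m/2⌋ this is the Laplace expansion of det T[ρ;σ] along
-- its first row. That T is skew symmetric only matters for words with repeated
-- letters, on which 𝒫 is 0 by definition: there pf vanishes as well.

open import Defs
open import Defs
open import Algebra.Bundles using (CommutativeRing)
open import Data.Bool.Base using (true; false)
open import Data.Fin.Base as Fin using (Fin; zero; suc; toℕ)
open import Data.Fin.Properties as Fin using (_≟_)
open import Data.Fin.Subset using (Subset; ∣_∣)
open import Data.List.Base as List
  using (List; []; _∷_; [_]; _++_; map; length; filter; concatMap; upTo)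
open import Data.List.Properties
  using (++-assoc; filter-all; filter-none; filter-accept; filter-reject; length-map; map-++;
         map-tabulate; map-upTo)
open import Data.List.Membership.DecPropositional using (_∈?_)
open import Data.List.Membership.Propositional.Properties using (∈-∃++)
open import Data.List.Relation.Binary.Permutation.Propositional
  using (_↭_; prep; swap; ↭-refl; ↭-sym; ↭-trans)
open import Data.List.Relation.Binary.Permutation.Propositional.Properties as ↭
  using (All-resp-↭; ↭-length; filter-↭; shift)
open import Data.List.Relation.Unary.All as All using (All; []; _∷_)
import Data.List.Relation.Unary.All.Properties as All
open import Data.List.Relation.Unary.AllPairs using (AllPairs; []; _∷_)
open import Data.List.Relation.Unary.Any using (here)
open import Data.List.Relation.Unary.Unique.DecPropositional using (unique?)
open import Data.List.Relation.Unary.Unique.Propositional using (Unique)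
open import Data.List.Relation.Unary.Unique.Propositional.Properties as Unique using (allFin⁺)
open import Data.Nat.Base as ℕ using (ℕ; zero; suc; ⌊_/2⌋; ⌈_/2⌉; _≤_; _<_; s≤s)
import Data.Nat.Properties as ℕ
open import Data.Product.Base using (_×_; _,_; ∃)
open import Data.Vec.Base as Vec using (Vec; []; _∷_; lookup; toList; removeAt)
open import Data.Vec.Properties
  using (length-toList; map-lookup-allFin; toList-cast; toList-map; toList∘fromList)
open import Function.Base using (id; _∘_)
open import Relation.Binary.PropositionalEquality as ≡ using (_≡_; _≢_)
open import Relation.Nullary.Decidable.Core using (yes; no; ¬?)
open import Relation.Nullary.Negation.Core using (¬_; contradiction)
open import Relation.Unary using (Pred)

-- Inversions

below : ℕ → List ℕ → ℕ
below a as = length (filter (ℕ._<? a) as)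

below-↭ : ∀ a {as bs} → as ↭ bs → below a as ≡ below a bs
below-↭ a p = ↭-length (filter-↭ (ℕ._<? a) p)

below-∷ : ∀ {a b} as → b < a → below a (b ∷ as) ≡ suc (below a as)
below-∷ {a} as b<a = ≡.cong length (filter-accept (ℕ._<? a) b<a)

below-minimum : ∀ {a as} → All (a <_) as → below a as ≡ 0
below-minimum {a} a<as =
  ≡.cong length (filter-none (ℕ._<? a) (All.map (λ a<b → ℕ.<-asym a<b) a<as))

-- The least entry `b` is inverted with each entry of `as` before it and with nothing after it. This
-- is the sign of moving a first letter past a subword.
inversions-insert : ∀ {b} as bs → All (b <_) as → All (b <_) bs →
  inversions (as ++ b ∷ bs) ≡ length as ℕ.+ inversions (as ++ bs)
inversions-insert {b} []       bs _            b<bs =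
  ≡.cong (ℕ._+ inversions bs) (below-minimum b<bs)
inversions-insert {b} (a ∷ as) bs (b<a ∷ b<as) b<bs = begin
  below a (as ++ b ∷ bs) ℕ.+ inversions (as ++ b ∷ bs)
    ≡⟨ ≡.cong₂ ℕ._+_ (≡.trans (below-↭ a (shift b as bs)) (below-∷ (as ++ bs) b<a))
         (inversions-insert as bs b<as b<bs) ⟩
  suc (below a (as ++ bs) ℕ.+ (length as ℕ.+ inversions (as ++ bs)))
    ≡⟨ ≡.cong suc (x+[y+z]≡y+[x+z] (below a (as ++ bs)) (length as) _) ⟩
  suc (length as ℕ.+ (below a (as ++ bs) ℕ.+ inversions (as ++ bs))) ∎
  where
  open ≡.≡-Reasoning
  open import Algebra.Properties.CommutativeSemigroup ℕ.+-commutativeSemigroup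
    using () renaming (x∙yz≈y∙xz to x+[y+z]≡y+[x+z])

inversions-minimum : ∀ {a as} → All (a <_) as → inversions (a ∷ as) ≡ inversions as
inversions-minimum {as = as} a<as = ≡.cong (ℕ._+ inversions as) (below-minimum a<as)

-- Selecting letters from a word on which a numbering increases.

module _ {x} {X : Set x} where

  lookup-removeAt-↭ : ∀ {k} (xs : Vec X (suc k)) i →
    lookup xs i ∷ toList (removeAt xs i) ↭ toList xs
  lookup-removeAt-↭ (x ∷ xs)         zero    = ↭-refl
  lookup-removeAt-↭ (x ∷ xs@(_ ∷ _)) (suc i) =
    ↭-trans (swap (lookup xs i) x ↭-refl) (prep x (lookup-removeAt-↭ xs i))

  permutations-↭ : ∀ {k} (xs : Vec X k) → All (λ π → toList π ↭ toList xs) (permutations xs)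
  permutations-↭ []           = ↭-refl ∷ []
  permutations-↭ xs@(_ ∷ _) = All.concat⁺ (All.map⁺ (All.tabulate⁺ {f = id} (λ i → All.map⁺
    (All.map (λ p → ↭-trans (prep (lookup xs i) p) (lookup-removeAt-↭ xs i))
      (permutations-↭ (removeAt xs i))))))

  pairings-↭ : ∀ {k} (xs : Vec X k) → All (λ p → flatten p ↭ toList xs) (pairings xs)
  pairings-↭ []                  = ↭-refl ∷ []
  pairings-↭ (_ ∷ [])            = []
  pairings-↭ (x ∷ xs@(_ ∷ _)) = All.concat⁺ (All.map⁺ (All.tabulate⁺ {f = id} (λ i → All.map⁺
    (All.map (λ p → prep x (↭-trans (prep (lookup xs i) p) (lookup-removeAt-↭ xs i)))
      (pairings-↭ (removeAt xs i))))))

  -- The numbering `f` is kept apart from the word: in applications it is `position` in the original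
  -- word. When letters are removed, the rest keeps its numbers and is still increasing, so signs
  -- can be followed through a recursion without renumbering.
  Increasing : (X → ℕ) → List X → Set x
  Increasing f = AllPairs (λ x y → f x < f y)

  module _ {f : X → ℕ} where

    removeAt-increasing : ∀ {k} (xs : Vec X (suc k)) i →
      Increasing f (toList xs) → Increasing f (toList (removeAt xs i))
    removeAt-increasing (x ∷ xs)         zero    (_ ∷ inc)   = inc
    removeAt-increasing (x ∷ xs@(_ ∷ _)) (suc i) (x< ∷ inc)
      with _ ∷ x<′ ← All-resp-↭ (↭-sym (lookup-removeAt-↭ xs i)) x<
      = x<′ ∷ removeAt-increasing xs i inc

    -- Since `f` increases along `xs`, the letters with a smaller number are exactly the `i` letters
    -- in front.
    below-lookup : ∀ {k} (xs : Vec X (suc k)) i → Increasing f (toList xs) →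
      below (f (lookup xs i)) (map f (toList (removeAt xs i))) ≡ toℕ i
    below-lookup (x ∷ xs)         zero    (x< ∷ _)   = below-minimum (All.map⁺ x<)
    below-lookup (x ∷ xs@(_ ∷ _)) (suc i) (x< ∷ inc)
      with x<xᵢ ∷ _ ← All-resp-↭ (↭-sym (lookup-removeAt-↭ xs i)) x<
      = ≡.trans (below-∷ _ x<xᵢ) (≡.cong suc (below-lookup xs i inc))

    -- Counting smaller entries ignores their order, so `w` may be replaced by the sorted remainder.
    -- This yields the factor (-1)ⁱ in expansions along a first letter or row.
    inversions-lookup-∷ : ∀ {k} (xs : Vec X (suc k)) i {w} → Increasing f (toList xs) →
      w ↭ toList (removeAt xs i) →
      inversions (map f (lookup xs i ∷ w)) ≡ toℕ i ℕ.+ inversions (map f w)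
    inversions-lookup-∷ xs i inc p = ≡.cong (ℕ._+ _)
      (≡.trans (below-↭ _ (↭.map⁺ f p)) (below-lookup xs i inc))

    inversions-increasing : ∀ w → Increasing f w → inversions (map f w) ≡ 0
    inversions-increasing []      []         = ≡.refl
    inversions-increasing (x ∷ w) (x< ∷ inc) =
      ≡.trans (inversions-minimum (All.map⁺ x<)) (inversions-increasing w inc)

toList-allFin : ∀ m → toList (Vec.allFin m) ≡ List.allFin m
toList-allFin m = toList-tabulate id
  where
  toList-tabulate : ∀ {k} {X : Set} (g : Fin k → X) → toList (Vec.tabulate g) ≡ List.tabulate g
  toList-tabulate {zero}  g = ≡.refl
  toList-tabulate {suc k} g = ≡.cong (g zero ∷_) (toList-tabulate (g ∘ suc))

-- Words and positions

module _ {n : ℕ} where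

  position-head : ∀ (x : Fin n) w → position (x ∷ w) x ≡ 0
  position-head x w with x ≟ x
  ... | yes _   = ≡.refl
  ... | no  x≢x = contradiction ≡.refl x≢x

  position-tail : ∀ {x y : Fin n} w → x ≢ y → position (x ∷ w) y ≡ suc (position w y)
  position-tail {x} {y} w x≢y with y ≟ x
  ... | yes y≡x = contradiction (≡.sym y≡x) x≢y
  ... | no  _   = ≡.refl

  -- This lets `sgn w` be treated by the results on increasing numberings, with `f` taken to be
  -- `position w`.
  position-increasing : ∀ (w : Word n) → Unique w → Increasing (position w) w
  position-increasing []      []        = []
  position-increasing (x ∷ w) (x∉w ∷ u) =
    All.map (λ x≢y → ≡.subst₂ _<_ (≡.sym (position-head x w)) (≡.sym (position-tail w x≢y)) ℕ.z<s) x∉w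
      ∷ shifted x∉w (position-increasing w u)
    where
    shifted : ∀ {v} → All (x ≢_) v → Increasing (position w) v → Increasing (position (x ∷ w)) v
    shifted []           []         = []
    shifted (x≢y ∷ x∉v) (y< ∷ inc) =
      All.zipWith (λ (x≢z , y<z) → ≡.subst₂ _<_ (≡.sym (position-tail w x≢y))
        (≡.sym (position-tail w x≢z)) (s≤s y<z)) (x∉v , y<)
        ∷ shifted x∉v inc

  repeated-letter : ∀ (w : Word n) → ¬ Unique w →
    ∃ λ u → ∃ λ x → ∃ λ v → ∃ λ v′ → w ≡ u ++ x ∷ v ++ x ∷ v′
  repeated-letter []      ¬uniq = contradiction [] ¬uniq
  repeated-letter (x ∷ w) ¬uniq with _∈?_ _≟_ x w
  ... | yes x∈w with v , v′ , eq ← ∈-∃++ x∈w = [] , x , v , v′ , ≡.cong (x ∷_) eq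
  ... | no  x∉w with u , y , v , v′ , eq ← repeated-letter w (¬uniq ∘ (All.¬Any⇒All¬ w x∉w ∷_))
    = x ∷ u , y , v , v′ , ≡.cong (x ∷_) eq

  ∖-[] : ∀ (w : Word n) → w ∖ [] ≡ w
  ∖-[] w = filter-all (λ x → ¬? (_∈?_ _≟_ x [])) (All.universal (λ _ ()) w)

  -- `_∖_` deletes by letter and not by place, so a further `x` in `v` would be lost as well; hence
  -- the condition on `v`.
  ∖-∷-∷ : ∀ {x} {v : Word n} (ω : Word n) → All (x ≢_) v → (x ∷ v) ∖ (x ∷ ω) ≡ v ∖ ω
  ∖-∷-∷ {x} ω x∉v = ≡.trans
    (filter-reject (λ y → ¬? (_∈?_ _≟_ y (x ∷ ω))) (λ x∉ → x∉ (here ≡.refl)))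
    (rest x∉v)
    where
    rest : ∀ {v} → All (x ≢_) v → v ∖ (x ∷ ω) ≡ v ∖ ω
    rest {[]}    []           = ≡.refl
    rest {y ∷ v} (x≢y ∷ x∉v) with y ≟ x | _∈?_ _≟_ y ω
    ... | yes y≡x | _     = contradiction (≡.sym y≡x) x≢y
    ... | no  _   | yes _ = rest x∉v
    ... | no  _   | no  _ = ≡.cong (y ∷_) (rest x∉v)

  ∖-∷ : ∀ {x} {ω : Word n} (v : Word n) → All (x ≢_) ω → (x ∷ v) ∖ ω ≡ x ∷ v ∖ ω
  ∖-∷ {ω = ω} v x∉ω = filter-accept (λ y → ¬? (_∈?_ _≟_ y ω)) (All.All¬⇒¬Any x∉ω)

  subwords-All : ∀ {p} {P : Pred (Fin n) p} l {w} → All P w → All (All P) (subwords l w)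
  subwords-All zero    _          = [] ∷ []
  subwords-All (suc l) []         = []
  subwords-All (suc l) (px ∷ pw) = All.++⁺
    (All.map⁺ (All.map (px ∷_) (subwords-All l pw))) (subwords-All (suc l) pw)

elements-unique : ∀ {n} (R : Subset n) → Unique (toList (elements R))
elements-unique []          = []
elements-unique (true  ∷ R) rewrite toList-map Fin.suc (elements R) =
  All.map⁺ (All.universal (λ _ ()) _) ∷ Unique.map⁺ Fin.suc-injective (elements-unique R)
elements-unique (false ∷ R) rewrite toList-map Fin.suc (elements R) =
  Unique.map⁺ Fin.suc-injective (elements-unique R)

module Expansion {c ℓ} (A : CommutativeRing c ℓ) where
  open CommutativeRing A hiding (zero)
  open Pfaffians A
  open import Algebra.Properties.Ring ring
    using (-1*x≈-x; -‿involutive; -‿distribˡ-*; -‿distribʳ-*; -‿+-comm; -0#≈0#)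
  open import Algebra.Properties.Semiring.Exp semiring using (^-homo-*)
  open import Algebra.Properties.CommutativeSemigroup *-commutativeSemigroup
    using (x∙yz≈y∙xz) renaming (interchange to *-interchange)
  open import Algebra.Properties.CommutativeSemigroup
    (CommutativeRing.+-commutativeSemigroup A)
    using () renaming (interchange to +-interchange; x∙yz≈y∙xz to +-exchange)
  open import Relation.Binary.Reasoning.Setoid setoid

  -- Signs

  ±1 : ℕ → Carrier
  ±1 k = (- 1#) ^ k

  ±1-suc : ∀ k → ±1 (suc k) ≈ - ±1 k
  ±1-suc k = -1*x≈-x (±1 k)

  ±1-square : ∀ k → ±1 k * ±1 k ≈ 1#
  ±1-square zero    = *-identityˡ 1#
  ±1-square (suc k) = begin
    (- 1# * ±1 k) * (- 1# * ±1 k)  ≈⟨ *-interchange (- 1#) (±1 k) (- 1#) (±1 k) ⟩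
    (- 1# * - 1#) * (±1 k * ±1 k)  ≈⟨ *-cong (-1*x≈-x (- 1#)) (±1-square k) ⟩
    - (- 1#) * 1#                  ≈⟨ *-identityʳ _ ⟩
    - (- 1#)                       ≈⟨ -‿involutive 1# ⟩
    1#                             ∎

  ±1-cancelˡ : ∀ k a → ±1 k * (±1 k * a) ≈ a
  ±1-cancelˡ k a = begin
    ±1 k * (±1 k * a)  ≈⟨ *-assoc _ _ _ ⟨
    (±1 k * ±1 k) * a  ≈⟨ *-congʳ (±1-square k) ⟩
    1# * a             ≈⟨ *-identityˡ a ⟩
    a                  ∎

  -- As `k` is the sum of its two halves, the lower half occurs twice and cancels. `⌈ k /2⌉` is
  -- `⌊ suc k /2⌋` by definition, so this carries the sign of the main identity from `k` to `suc k`.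
  ±1-⌊/2⌋ : ∀ k → ±1 k * ±1 ⌊ k /2⌋ ≈ ±1 ⌈ k /2⌉
  ±1-⌊/2⌋ k = begin
    ±1 k * ±1 ⌊ k /2⌋
      ≡⟨ ≡.cong (λ l → ±1 l * ±1 ⌊ k /2⌋) (≡.sym (ℕ.⌊n/2⌋+⌈n/2⌉≡n k)) ⟩
    ±1 (⌊ k /2⌋ ℕ.+ ⌈ k /2⌉) * ±1 ⌊ k /2⌋
      ≈⟨ *-congʳ (^-homo-* (- 1#) ⌊ k /2⌋ ⌈ k /2⌉) ⟩
    (±1 ⌊ k /2⌋ * ±1 ⌈ k /2⌉) * ±1 ⌊ k /2⌋
      ≈⟨ *-comm _ _ ⟩
    ±1 ⌊ k /2⌋ * (±1 ⌊ k /2⌋ * ±1 ⌈ k /2⌉)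
      ≈⟨ ±1-cancelˡ ⌊ k /2⌋ _ ⟩
    ±1 ⌈ k /2⌉ ∎

  -- Contractions

  module _ {x} {X : Set x} where

    private variable
      G H : X → List X → Carrier

    ε : List X → Carrier
    ε w = ±1 (length w)

    -- Σᵢ (-1)ⁱ G wᵢ (w without wᵢ), counting positions from 0.
    contract : (X → List X → Carrier) → List X → Carrier
    contract G []      = 0#
    contract G (x ∷ w) = G x w - contract (λ y w′ → G y (x ∷ w′)) w

    -- The length equation serves arguments that depend on the size of the remaining word:
    -- inductions with a length bound, and the sign `ε w′`.
    contract-cong-length : ∀ w →
      (∀ y w′ → length w ≡ suc (length w′) → G y w′ ≈ H y w′) →
      contract G w ≈ contract H w
    contract-cong-length []      eq = refl
    contract-cong-length (x ∷ w) eq = +-cong (eq x w ≡.refl)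
      (-‿cong (contract-cong-length w (λ y w′ p → eq y (x ∷ w′) (≡.cong suc p))))

    contract-cong : (∀ y w′ → G y w′ ≈ H y w′) → ∀ w → contract G w ≈ contract H w
    contract-cong eq w = contract-cong-length w (λ y w′ _ → eq y w′)

    contract-0 : ∀ w → contract (λ _ _ → 0#) w ≈ 0#
    contract-0 []      = refl
    contract-0 (x ∷ w) = begin
      0# - contract (λ _ _ → 0#) w  ≈⟨ +-identityˡ _ ⟩
      - contract (λ _ _ → 0#) w     ≈⟨ -‿cong (contract-0 w) ⟩
      - 0#                          ≈⟨ -0#≈0# ⟩
      0#                            ∎

    contract-+ : ∀ w → contract (λ y w′ → G y w′ + H y w′) w ≈ contract G w + contract H w
    contract-+ []      = sym (+-identityˡ 0#)
    contract-+ {G} {H} (x ∷ w) = begin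
      (G x w + H x w) - contract (λ y w′ → G y (x ∷ w′) + H y (x ∷ w′)) w
        ≈⟨ +-congˡ (-‿cong (contract-+ w)) ⟩
      (G x w + H x w) - (contract G′ w + contract H′ w)
        ≈⟨ +-congˡ (sym (-‿+-comm _ _)) ⟩
      (G x w + H x w) + (- contract G′ w - contract H′ w)
        ≈⟨ +-interchange _ _ _ _ ⟩
      (G x w - contract G′ w) + (H x w - contract H′ w) ∎
      where
      G′ H′ : X → List X → Carrier
      G′ y w′ = G y (x ∷ w′)
      H′ y w′ = H y (x ∷ w′)

    contract-*ˡ : ∀ a w → contract (λ y w′ → a * G y w′) w ≈ a * contract G w
    contract-*ˡ a []          = sym (zeroʳ a)
    contract-*ˡ {G} a (x ∷ w) = begin
      a * G x w - contract (λ y w′ → a * G y (x ∷ w′)) w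
        ≈⟨ +-congˡ (-‿cong (contract-*ˡ a w)) ⟩
      a * G x w - a * contract (λ y w′ → G y (x ∷ w′)) w
        ≈⟨ +-congˡ (-‿distribʳ-* a _) ⟩
      a * G x w + a * - contract (λ y w′ → G y (x ∷ w′)) w
        ≈⟨ distribˡ a _ _ ⟨
      a * (G x w - contract (λ y w′ → G y (x ∷ w′)) w) ∎

    contract-neg : ∀ w → contract (λ y w′ → - G y w′) w ≈ - contract G w
    contract-neg {G} w = begin
      contract (λ y w′ → - G y w′) w       ≈⟨ contract-cong (λ y w′ → sym (-1*x≈-x _)) w ⟩
      contract (λ y w′ → - 1# * G y w′) w  ≈⟨ contract-*ˡ (- 1#) w ⟩
      - 1# * contract G w                  ≈⟨ -1*x≈-x _ ⟩
      - contract G w                       ∎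

    -- Every `w′` is one letter shorter than `w`, so `ε w′` is the constant `- ε w`.
    contract-ε : ∀ w → contract (λ y w′ → ε w′ * G y w′) w ≈ - (ε w * contract G w)
    contract-ε {G} w = begin
      contract (λ y w′ → ε w′ * G y w′) w   ≈⟨ contract-cong-length w step ⟩
      contract (λ y w′ → - ε w * G y w′) w  ≈⟨ contract-*ˡ (- ε w) w ⟩
      - ε w * contract G w                  ≈⟨ -‿distribˡ-* _ _ ⟨
      - (ε w * contract G w)                ∎
      where
      step : ∀ y w′ → length w ≡ suc (length w′) → ε w′ * G y w′ ≈ - ε w * G y w′
      step y w′ p = *-congʳ (begin
        ε w′                     ≈⟨ -‿involutive _ ⟨
        - (- ε w′)               ≈⟨ -‿cong (sym (±1-suc (length w′))) ⟩
        - ±1 (suc (length w′))   ≡⟨ ≡.cong (λ k → - ±1 k) (≡.sym p) ⟩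
        - ε w                    ∎)

    -- A letter of `v` stands `length u` places further along in `u ++ v`, whence the factor `ε u`.
    contract-++ : ∀ u v → contract G (u ++ v) ≈
      contract (λ y u′ → G y (u′ ++ v)) u + ε u * contract (λ y v′ → G y (u ++ v′)) v
    contract-++ []      v = sym (trans (+-identityˡ _) (*-identityˡ _))
    contract-++ {G} (x ∷ u) v = begin
      G x (u ++ v) - contract (λ y w′ → G y (x ∷ w′)) (u ++ v)
        ≈⟨ +-congˡ (-‿cong (contract-++ u v)) ⟩
      G x (u ++ v) - (U + ε u * V)
        ≈⟨ +-congˡ (sym (-‿+-comm _ _)) ⟩
      G x (u ++ v) + (- U - ε u * V)
        ≈⟨ +-assoc _ _ _ ⟨
      (G x (u ++ v) - U) - ε u * V
        ≈⟨ +-congˡ (trans (-‿distribˡ-* _ _) (*-congʳ (sym (±1-suc (length u))))) ⟩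
      (G x (u ++ v) - U) + ε (x ∷ u) * V ∎
      where
      U V : Carrier
      U = contract (λ y u′ → G y (x ∷ u′ ++ v)) u
      V = contract (λ y v′ → G y (x ∷ u ++ v′)) v

    -- Removing two letters in either order leaves the same word, but the later letter moves up one
    -- place if the earlier one goes first. The two terms thus have opposite signs. They cancel in
    -- pairs, so no division by 2 occurs.
    contract-symmetric : ∀ {K : X → X → List X → Carrier} →
      (∀ y z w → K y z w ≈ K z y w) →
      ∀ w → contract (λ y → contract (K y)) w ≈ 0#
    contract-symmetric     K-sym []      = refl
    contract-symmetric {K} K-sym (x ∷ w) = begin
      contract (K x) w - contract (λ y w′ → K y x w′ - contract (K′ y) w′) w
        ≈⟨ +-congˡ (-‿cong (trans (contract-+ w) (+-cong
             (contract-cong (λ y w′ → K-sym y x w′) w)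
             (contract-neg w)))) ⟩
      contract (K x) w - (contract (K x) w - contract (λ y → contract (K′ y)) w)
        ≈⟨ +-congˡ (-‿cong (+-congˡ (-‿cong
             (contract-symmetric (λ y z w′ → K-sym y z (x ∷ w′)) w)))) ⟩
      contract (K x) w - (contract (K x) w - 0#)
        ≈⟨ +-congˡ (-‿cong (trans (+-congˡ -0#≈0#) (+-identityʳ _))) ⟩
      contract (K x) w - contract (K x) w
        ≈⟨ -‿inverseʳ _ ⟩
      0# ∎
      where
      K′ : X → X → List X → Carrier
      K′ y z w′ = K y z (x ∷ w′)

  contract-map : ∀ {x y} {X : Set x} {Y : Set y} (f : Y → X)
    (G : X → List X → Carrier) (w : List Y) →
    contract G (map f w) ≡ contract (λ y w′ → G (f y) (map f w′)) w
  contract-map f G []      = ≡.refl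
  contract-map f G (x ∷ w) = ≡.cong (λ a → G (f x) (map f w) - a)
    (contract-map f (λ y w′ → G y (f x ∷ w′)) w)

  -- Signed sums over splittings of a word, and Pfaffians.

  module _ {x} {X : Set x} where

    private variable
      G H : X → List X → Carrier
      K L : List X → List X → Carrier

    -- Σ ± K ω τ over the 2^|w| ways of splitting w into a subword ω and the
    -- complementary subword τ, with the sign of the rearrangement of w into ω τ:
    -- the factor ε ω moves the letter x past ω.
    unshuffle : (List X → List X → Carrier) → List X → Carrier
    unshuffle K []      = K [] []
    unshuffle K (x ∷ w) = unshuffle (λ ω τ → K (x ∷ ω) τ) w
                        + unshuffle (λ ω τ → ε ω * K ω (x ∷ τ)) w

    unshuffle-cong-length : ∀ w →
      (∀ ω τ → length ω ℕ.+ length τ ≡ length w → K ω τ ≈ L ω τ) →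
      unshuffle K w ≈ unshuffle L w
    unshuffle-cong-length []      eq = eq [] [] ≡.refl
    unshuffle-cong-length (x ∷ w) eq = +-cong
      (unshuffle-cong-length w (λ ω τ p → eq (x ∷ ω) τ (≡.cong suc p)))
      (unshuffle-cong-length w (λ ω τ p → *-congˡ
        (eq ω (x ∷ τ) (≡.trans (ℕ.+-suc _ _) (≡.cong suc p)))))

    unshuffle-cong : (∀ ω τ → K ω τ ≈ L ω τ) → ∀ w → unshuffle K w ≈ unshuffle L w
    unshuffle-cong eq w = unshuffle-cong-length w (λ ω τ _ → eq ω τ)

    unshuffle-+ : ∀ w → unshuffle (λ ω τ → K ω τ + L ω τ) w ≈ unshuffle K w + unshuffle L w
    unshuffle-+ []      = refl
    unshuffle-+ (x ∷ w) = begin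
      _ ≈⟨ +-cong (unshuffle-+ w)
             (trans (unshuffle-cong (λ ω τ → distribˡ (ε ω) _ _) w) (unshuffle-+ w)) ⟩
      _ ≈⟨ +-interchange _ _ _ _ ⟩
      _ ∎

    unshuffle-*ˡ : ∀ a w → unshuffle (λ ω τ → a * K ω τ) w ≈ a * unshuffle K w
    unshuffle-*ˡ a []      = refl
    unshuffle-*ˡ a (x ∷ w) = begin
      _ ≈⟨ +-cong (unshuffle-*ˡ a w)
             (trans (unshuffle-cong (λ ω τ → x∙yz≈y∙xz (ε ω) a _) w) (unshuffle-*ˡ a w)) ⟩
      _ ≈⟨ distribˡ a _ _ ⟨
      _ ∎

    unshuffle-neg : ∀ w → unshuffle (λ ω τ → - K ω τ) w ≈ - unshuffle K w
    unshuffle-neg w = begin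
      _ ≈⟨ unshuffle-cong (λ ω τ → sym (-1*x≈-x _)) w ⟩
      _ ≈⟨ unshuffle-*ˡ (- 1#) w ⟩
      _ ≈⟨ -1*x≈-x _ ⟩
      _ ∎

    unshuffle-0 : ∀ w → unshuffle (λ _ _ → 0#) w ≈ 0#
    unshuffle-0 w = begin
      unshuffle (λ _ _ → 0#) w       ≈⟨ unshuffle-cong (λ _ _ → sym (zeroˡ 0#)) w ⟩
      unshuffle (λ _ _ → 0# * 0#) w  ≈⟨ unshuffle-*ˡ 0# w ⟩
      0# * _                         ≈⟨ zeroˡ _ ⟩
      0#                             ∎

    private
      telescope : ∀ a b c → (a - b) + (- c) ≈ a - (b + c)
      telescope a b c = trans (+-assoc a _ _) (+-congˡ (-‿+-comm b c))

    -- Contraction is a derivation for the splitting of words: removing a letter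
    -- and then splitting amounts to splitting and then removing a letter from ω,
    -- or from τ with the extra sign ε ω.
    unshuffle-contractˡ : ∀ {J : X → List X → List X → Carrier} w →
      unshuffle (λ ω τ → contract (λ y ω′ → J y ω′ τ) ω) w ≈
      contract (λ y → unshuffle (J y)) w
    unshuffle-contractˡ     []      = refl
    unshuffle-contractˡ {J} (x ∷ w) = begin
      unshuffle (λ ω τ → J x ω τ - contract (λ y ω′ → J y (x ∷ ω′) τ) ω) w
        + unshuffle (λ ω τ → ε ω * contract (λ y ω′ → J y ω′ (x ∷ τ)) ω) w
        ≈⟨ +-cong
             (trans (unshuffle-+ w) (+-congˡ (trans (unshuffle-neg w)
               (-‿cong (unshuffle-contractˡ w)))))
             -- By `contract-ε` the factor `ε ω` enters the contraction as `- ε ω′`, the form in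
             -- which the induction hypothesis applies.
             (trans (unshuffle-cong (λ ω τ → trans (sym (-‿involutive _))
                 (-‿cong (sym (contract-ε ω)))) w)
               (trans (unshuffle-neg w) (-‿cong (unshuffle-contractˡ w)))) ⟩
      (unshuffle (J x) w - contract (λ y → unshuffle (λ ω τ → J y (x ∷ ω) τ)) w)
        - contract (λ y → unshuffle (λ ω τ → ε ω * J y ω (x ∷ τ))) w
        ≈⟨ telescope _ _ _ ⟩
      unshuffle (J x) w - (contract (λ y → unshuffle (λ ω τ → J y (x ∷ ω) τ)) w
        + contract (λ y → unshuffle (λ ω τ → ε ω * J y ω (x ∷ τ))) w)
        ≈⟨ +-congˡ (-‿cong (sym (contract-+ w))) ⟩
      unshuffle (J x) w - contract (λ y w′ → unshuffle (J y) (x ∷ w′)) w ∎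

    unshuffle-contractʳ : ∀ {J : X → List X → List X → Carrier} w →
      unshuffle (λ ω τ → ε ω * contract (λ y → J y ω) τ) w ≈
      contract (λ y → unshuffle (J y)) w
    unshuffle-contractʳ     []      = zeroʳ _
    unshuffle-contractʳ {J} (x ∷ w) = begin
      unshuffle (λ ω τ → ε (x ∷ ω) * contract (λ y → J y (x ∷ ω)) τ) w
        + unshuffle (λ ω τ → ε ω * (ε ω * (J x ω τ - contract (λ y τ′ → J y ω (x ∷ τ′)) τ))) w
        ≈⟨ +-cong
             (trans (unshuffle-cong (λ ω τ → trans (*-congʳ (±1-suc (length ω)))
                 (sym (-‿distribˡ-* _ _))) w)
               (trans (unshuffle-neg w) (-‿cong (unshuffle-contractʳ w))))
             -- The two factors `ε ω` cancel. In the second term they are put back, one outside and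
             -- one inside the contraction, to match the induction hypothesis.
             (unshuffle-cong (λ ω τ → trans (±1-cancelˡ (length ω) _) (+-congˡ (-‿cong
               (sym (trans (*-congˡ (contract-*ˡ (ε ω) τ)) (±1-cancelˡ (length ω) _)))))) w) ⟩
      - contract (λ y → unshuffle (λ ω → J y (x ∷ ω))) w
        + unshuffle (λ ω τ → J x ω τ - ε ω * contract (λ y τ′ → ε ω * J y ω (x ∷ τ′)) τ) w
        ≈⟨ +-congˡ (trans (unshuffle-+ w) (+-congˡ (trans (unshuffle-neg w)
             (-‿cong (unshuffle-contractʳ w))))) ⟩
      - contract (λ y → unshuffle (λ ω → J y (x ∷ ω))) w
        + (unshuffle (J x) w - contract (λ y → unshuffle (λ ω τ → ε ω * J y ω (x ∷ τ))) w)
        ≈⟨ +-exchange _ _ _ ⟩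
      unshuffle (J x) w + (- contract (λ y → unshuffle (λ ω → J y (x ∷ ω))) w
        - contract (λ y → unshuffle (λ ω τ → ε ω * J y ω (x ∷ τ))) w)
        ≈⟨ +-congˡ (trans (-‿+-comm _ _) (-‿cong (sym (contract-+ w)))) ⟩
      unshuffle (J x) w - contract (λ y w′ → unshuffle (J y) (x ∷ w′)) w ∎

    unshuffle-contract-comm : ∀ {J : X → List X → List X → List X → Carrier} v w →
      unshuffle (λ ω τ → contract (λ y v′ → J y v′ ω τ) v) w ≈
      contract (λ y v′ → unshuffle (J y v′) w) v
    unshuffle-contract-comm []      w = unshuffle-0 w
    unshuffle-contract-comm (x ∷ v) w = trans (unshuffle-+ w)
      (+-congˡ (trans (unshuffle-neg w) (-‿cong (unshuffle-contract-comm v w))))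

    -- Pfaffians of words by expansion along the first letter

    -- The number bounds the recursion, since the shortened word is not a subterm. Each step uses
    -- one unit and two letters, so from a bound of at least the length the value 0 at an exhausted
    -- bound is never reached. A single letter gives an empty contraction, so words of odd length
    -- get 0.
    pfaffianWithin : (X → X → Carrier) → ℕ → List X → Carrier
    pfaffianWithin t _       []      = 1#
    pfaffianWithin t zero    (x ∷ w) = 0#
    pfaffianWithin t (suc f) (x ∷ w) = contract (λ y w′ → t x y * pfaffianWithin t f w′) w

    pfaffian : (X → X → Carrier) → List X → Carrier
    pfaffian t w = pfaffianWithin t (length w) w

    module _ (t : X → X → Carrier) where

      private
        pf : List X → Carrier
        pf = pfaffian t

      pfaffianWithin-stable : ∀ f g w → length w ≤ f → length w ≤ g →
        pfaffianWithin t f w ≈ pfaffianWithin t g w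
      pfaffianWithin-stable f       g       []      _         _         = refl
      pfaffianWithin-stable (suc f) (suc g) (x ∷ w) (s≤s w≤f) (s≤s w≤g) =
        contract-cong-length w (λ y w′ p → *-congˡ (pfaffianWithin-stable f g w′
          (shorter p w≤f) (shorter p w≤g)))
        where
        shorter : ∀ {k l m} → k ≡ suc l → k ≤ m → l ≤ m
        shorter ≡.refl = ℕ.<⇒≤

      pfaffian-∷ : ∀ x w → pf (x ∷ w) ≈ contract (λ y w′ → t x y * pf w′) w
      pfaffian-∷ x w = contract-cong-length w (λ y w′ p → *-congˡ
        (pfaffianWithin-stable (length w) (length w′) w′
          (ℕ.<⇒≤ (ℕ.≤-reflexive (≡.sym p))) ℕ.≤-refl))

      pfaffian-∷-++ : ∀ x u v → pf (x ∷ u ++ v) ≈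
        contract (λ y u′ → t x y * pf (u′ ++ v)) u
          + ε u * contract (λ y v′ → t x y * pf (u ++ v′)) v
      pfaffian-∷-++ x u v = trans (pfaffian-∷ x (u ++ v)) (contract-++ u v)

      module Alternating
        (skew : ∀ x y → t y x ≈ - t x y) (alt : ∀ x → t x x ≈ 0#) where

        private
          cancels : ∀ {a b} → b ≈ - a → a + b ≈ 0#
          cancels {a} b≈-a = trans (+-congˡ b≈-a) (-‿inverseʳ a)

          0-0≈0 : ∀ {a b} → a ≈ 0# → b ≈ 0# → a - b ≈ 0#
          0-0≈0 a≈0 b≈0 = trans (+-cong a≈0 (trans (-‿cong b≈0) -0#≈0#)) (+-identityˡ 0#)

          -- Either `x` is matched with `y`, or with some `a` in `v`; in that case `y` comes first
          -- in what remains and is matched with some `b`.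
          twice : ∀ x y v → pf (x ∷ y ∷ v) ≈
            t x y * pf v - contract (λ a → contract (λ b v″ → t x a * (t y b * pf v″))) v
          twice x y v = trans (pfaffian-∷ x (y ∷ v)) (+-congˡ (-‿cong (contract-cong
            (λ a v′ → trans (*-congˡ (pfaffian-∷ y v′)) (sym (contract-*ˡ (t x a) v′))) v)))

        -- The terms matching `x` with `y` cancel by skew symmetry. In the sum of the two double
        -- contractions, exchanging `a` and `b` exchanges the two summands, so `contract-symmetric`
        -- applies.
        pfaffian-swap₀ : ∀ x y v → pf (x ∷ y ∷ v) + pf (y ∷ x ∷ v) ≈ 0#
        pfaffian-swap₀ x y v = begin
          pf (x ∷ y ∷ v) + pf (y ∷ x ∷ v)
            ≈⟨ +-cong (twice x y v) (twice y x v) ⟩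
          (t x y * pf v - D x y) + (t y x * pf v - D y x)
            ≈⟨ +-interchange _ _ _ _ ⟩
          (t x y * pf v + t y x * pf v) + (- D x y - D y x)
            ≈⟨ +-cong (cancels (trans (*-congʳ (skew x y)) (sym (-‿distribˡ-* _ _))))
                 (-‿+-comm _ _) ⟩
          0# - (D x y + D y x)
            ≈⟨ 0-0≈0 refl (begin
                 D x y + D y x
                   ≈⟨ contract-+ v ⟨
                 contract (λ a v′ → contract (B x y a) v′ + contract (B y x a) v′) v
                   ≈⟨ contract-cong (λ a v′ → sym (contract-+ v′)) v ⟩
                 contract (λ a → contract (λ b v″ → B x y a b v″ + B y x a b v″)) v
                   ≈⟨ contract-symmetric (λ a b v″ → trans (+-comm _ _)
                        (+-cong (x∙yz≈y∙xz _ _ _) (x∙yz≈y∙xz _ _ _))) v ⟩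
                 0# ∎) ⟩
          0# ∎
          where
          B : X → X → X → X → List X → Carrier
          B x y a b v″ = t x a * (t y b * pf v″)
          D : X → X → Carrier
          D x y = contract (λ a → contract (B x y a)) v

        pfaffian-square₀ : ∀ x v → pf (x ∷ x ∷ v) ≈ 0#
        pfaffian-square₀ x v = trans (twice x x v) (0-0≈0
          (trans (*-congʳ (alt x)) (zeroˡ _))
          (contract-symmetric (λ a b v″ → x∙yz≈y∙xz _ _ _) v))

        -- The induction is on a bound for the length of u: expanding along the
        -- first letter shortens u by one letter or two.
        private
          swapWithin : ∀ f u x y v → length u ≤ f →
            pf (u ++ x ∷ y ∷ v) + pf (u ++ y ∷ x ∷ v) ≈ 0#
          swapWithin f       []      x y v _         = pfaffian-swap₀ x y v
          swapWithin (suc f) (z ∷ u) x y v (s≤s u≤f) = begin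
            pf (z ∷ u ++ x ∷ y ∷ v) + pf (z ∷ u ++ y ∷ x ∷ v)
              ≈⟨ +-cong (pfaffian-∷-++ z u (x ∷ y ∷ v)) (pfaffian-∷-++ z u (y ∷ x ∷ v)) ⟩
            (C x y + ε u * E x y) + (C y x + ε u * E y x)
              ≈⟨ +-interchange _ _ _ _ ⟩
            (C x y + C y x) + (ε u * E x y + ε u * E y x)
              ≈⟨ +-cong C≈0 (trans (sym (distribˡ _ _ _)) (trans (*-congˡ E≈0) (zeroʳ _))) ⟩
            0# + 0#
              ≈⟨ +-identityˡ 0# ⟩
            0# ∎
            where
            C E Q : X → X → Carrier
            C x y = contract (λ a u′ → t z a * pf (u′ ++ x ∷ y ∷ v)) u
            E x y = contract (λ a v′ → t z a * pf (u ++ v′)) (x ∷ y ∷ v)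
            Q x y = contract (λ a v′ → t z a * pf (u ++ x ∷ y ∷ v′)) v
            P : X → X → Carrier
            P x y = t z x * pf (u ++ y ∷ v)

            sums-to-0 : ∀ a {b c} → b + c ≈ 0# → a * b + a * c ≈ 0#
            sums-to-0 a eq = trans (sym (distribˡ a _ _)) (trans (*-congˡ eq) (zeroʳ a))

            C≈0 : C x y + C y x ≈ 0#
            C≈0 = trans (sym (contract-+ u)) (trans
              (contract-cong-length u (λ a u′ p → sums-to-0 (t z a)
                (swapWithin f u′ x y v (ℕ.<⇒≤ (≡.subst (_≤ f) p u≤f)))))
              (contract-0 u))

            Q≈0 : Q x y + Q y x ≈ 0#
            Q≈0 = trans (sym (contract-+ v)) (trans
              (contract-cong (λ a v′ → sums-to-0 (t z a) (swapWithin f u x y v′ u≤f)) v)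
              (contract-0 v))

            -- The partner of `z` is `x`, `y` or a letter of `v`. The first two contributions change
            -- sign under exchange of `x` and `y`; the last is left to the induction hypothesis.
            unfold : ∀ x y → E x y ≈ (P x y - P y x) + Q x y
            unfold x y = begin
              P x y - (P y x - Q x y)      ≈⟨ +-congˡ (-‿+-comm _ _) ⟨
              P x y + (- P y x - - Q x y)  ≈⟨ +-congˡ (+-congˡ (-‿involutive _)) ⟩
              P x y + (- P y x + Q x y)    ≈⟨ +-assoc _ _ _ ⟨
              (P x y - P y x) + Q x y      ∎

            E≈0 : E x y + E y x ≈ 0#
            E≈0 = begin
              E x y + E y x
                ≈⟨ +-cong (unfold x y) (unfold y x) ⟩
              ((P x y - P y x) + Q x y) + ((P y x - P x y) + Q y x)
                ≈⟨ +-interchange _ _ _ _ ⟩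
              ((P x y - P y x) + (P y x - P x y)) + (Q x y + Q y x)
                ≈⟨ +-cong (cancels (trans (+-comm _ _) (trans
                     (+-congˡ (sym (-‿involutive _))) (-‿+-comm _ _)))) Q≈0 ⟩
              0# + 0#
                ≈⟨ +-identityˡ 0# ⟩
              0# ∎

          squareWithin : ∀ f u x v → length u ≤ f → pf (u ++ x ∷ x ∷ v) ≈ 0#
          squareWithin f       []      x v _         = pfaffian-square₀ x v
          squareWithin (suc f) (z ∷ u) x v (s≤s u≤f) = begin
            pf (z ∷ u ++ x ∷ x ∷ v)
              ≈⟨ pfaffian-∷-++ z u (x ∷ x ∷ v) ⟩
            -- Matching `z` with either copy of `x` leaves the same word, and the copies are
            -- adjacent, so the two terms `P` have opposite signs.
            contract (λ a u′ → t z a * pf (u′ ++ x ∷ x ∷ v)) u + ε u * (P - (P - Q))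
              ≈⟨ +-cong
                   (trans (contract-cong-length u (λ a u′ p → trans (*-congˡ
                      (squareWithin f u′ x v (ℕ.<⇒≤ (≡.subst (_≤ f) p u≤f)))) (zeroʳ _)))
                     (contract-0 u))
                   (trans (*-congˡ (cancels (-‿cong (trans (+-congˡ (trans (-‿cong Q≈0) -0#≈0#))
                     (+-identityʳ P))))) (zeroʳ _)) ⟩
            0# + 0#
              ≈⟨ +-identityˡ 0# ⟩
            0# ∎
            where
            P Q : Carrier
            P = t z x * pf (u ++ x ∷ v)
            Q = contract (λ a v′ → t z a * pf (u ++ x ∷ x ∷ v′)) v
            Q≈0 : Q ≈ 0#
            Q≈0 = trans (contract-cong (λ a v′ → trans (*-congˡ (squareWithin f u x v′ u≤f))
              (zeroʳ _)) v) (contract-0 v)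

        pfaffian-swap : ∀ u x y v → pf (u ++ x ∷ y ∷ v) + pf (u ++ y ∷ x ∷ v) ≈ 0#
        pfaffian-swap u x y v = swapWithin (length u) u x y v ℕ.≤-refl

        -- Exchanging the first `x` with its right neighbour changes the sign and narrows the gap
        -- between the two copies, until they are adjacent.
        pfaffian-repeat : ∀ u x v w → pf (u ++ x ∷ v ++ x ∷ w) ≈ 0#
        pfaffian-repeat u x []      w = squareWithin (length u) u x w ℕ.≤-refl
        pfaffian-repeat u x (y ∷ v) w = begin
          pf (u ++ x ∷ y ∷ v ++ x ∷ w)
            ≈⟨ +-identityʳ _ ⟨
          pf (u ++ x ∷ y ∷ v ++ x ∷ w) + 0#
            ≈⟨ +-congˡ moved ⟨
          pf (u ++ x ∷ y ∷ v ++ x ∷ w) + pf (u ++ y ∷ x ∷ v ++ x ∷ w)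
            ≈⟨ pfaffian-swap u x y (v ++ x ∷ w) ⟩
          0# ∎
          where
          moved : pf (u ++ y ∷ x ∷ v ++ x ∷ w) ≈ 0#
          moved = ≡.subst (λ w′ → pf w′ ≈ 0#) (++-assoc u [ y ] (x ∷ v ++ x ∷ w))
            (pfaffian-repeat (u ++ [ y ]) x v w)

    -- The Laplace expansion

    -- For `w` of length `k` this is the determinant with rows `Fin k` and columns the letters of
    -- `w`, expanded along the first row.
    laplace : ∀ k → (Fin k → X → Carrier) → List X → Carrier
    laplace zero    M w = 1#
    laplace (suc k) M w = contract (λ y w′ → M zero y * laplace k (λ i → M (suc i)) w′) w

    -- The mixed sum of products of two Pfaffians.

    module _ (t : X → X → Carrier) where

      private
        pf pf⁻ : List X → Carrier
        pf  = pfaffian t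
        pf⁻ = pfaffian (λ x y → - t x y)

      mixed : List X → List X → Carrier
      mixed ρ σ = unshuffle (λ ω τ → pf⁻ ω * pf (τ ++ σ)) ρ

      -- Matching `x` within `ω` or within `τ` removes a letter from that part of the splitting. By
      -- the two derivation rules both cases become the same contraction of `ρ`, with summand `J`,
      -- and the minus sign in `pf⁻` makes them cancel.
      mixed-∷ : ∀ x ρ σ →
        mixed (x ∷ ρ) σ ≈ ε ρ * contract (λ y σ′ → t x y * mixed ρ σ′) σ
      mixed-∷ x ρ σ = begin
        unshuffle (λ ω τ → pf⁻ (x ∷ ω) * pf (τ ++ σ)) ρ
          + unshuffle (λ ω τ → ε ω * (pf⁻ ω * pf (x ∷ τ ++ σ))) ρ
          ≈⟨ +-cong
               (trans (unshuffle-cong paired-in-ω ρ) (trans (unshuffle-neg ρ)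
                 (-‿cong (unshuffle-contractˡ ρ))))
               (trans (unshuffle-cong-length ρ paired-in-τ-or-σ) (trans (unshuffle-+ ρ)
                 (+-cong (unshuffle-contractʳ ρ) (unshuffle-*ˡ (ε ρ) ρ)))) ⟩
        - contract (λ y → unshuffle (J y)) ρ
          + (contract (λ y → unshuffle (J y)) ρ
            + ε ρ * unshuffle (λ ω τ → contract (λ y σ′ → t x y * (pf⁻ ω * pf (τ ++ σ′))) σ) ρ)
          ≈⟨ +-assoc _ _ _ ⟨
        (- contract (λ y → unshuffle (J y)) ρ + contract (λ y → unshuffle (J y)) ρ)
            + ε ρ * unshuffle (λ ω τ → contract (λ y σ′ → t x y * (pf⁻ ω * pf (τ ++ σ′))) σ) ρ
          ≈⟨ trans (+-congʳ (-‿inverseˡ _)) (+-identityˡ _) ⟩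
        ε ρ * unshuffle (λ ω τ → contract (λ y σ′ → t x y * (pf⁻ ω * pf (τ ++ σ′))) σ) ρ
          ≈⟨ *-congˡ (trans (unshuffle-contract-comm σ ρ)
               (contract-cong (λ y σ′ → unshuffle-*ˡ (t x y) ρ) σ)) ⟩
        ε ρ * contract (λ y σ′ → t x y * mixed ρ σ′) σ ∎
        where
        J : X → List X → List X → Carrier
        J y ω τ = t x y * (pf⁻ ω * pf (τ ++ σ))

        paired-in-ω : ∀ ω τ → pf⁻ (x ∷ ω) * pf (τ ++ σ) ≈ - contract (λ y ω′ → J y ω′ τ) ω
        paired-in-ω ω τ = begin
          pf⁻ (x ∷ ω) * pf (τ ++ σ)
            ≈⟨ *-congʳ (pfaffian-∷ _ x ω) ⟩
          contract (λ y ω′ → - t x y * pf⁻ ω′) ω * pf (τ ++ σ)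
            ≈⟨ *-comm _ _ ⟩
          pf (τ ++ σ) * contract (λ y ω′ → - t x y * pf⁻ ω′) ω
            ≈⟨ contract-*ˡ _ ω ⟨
          contract (λ y ω′ → pf (τ ++ σ) * (- t x y * pf⁻ ω′)) ω
            ≈⟨ contract-cong (λ y ω′ → trans (*-comm _ _) (trans (*-assoc _ _ _)
                 (sym (-‿distribˡ-* _ _)))) ω ⟩
          contract (λ y ω′ → - J y ω′ τ) ω
            ≈⟨ contract-neg ω ⟩
          - contract (λ y ω′ → J y ω′ τ) ω ∎

        ε-ε : ∀ ω τ → length ω ℕ.+ length τ ≡ length ρ → ε ω * ε τ ≈ ε ρ
        ε-ε ω τ p = trans (sym (^-homo-* (- 1#) (length ω) (length τ)))
          (reflexive (≡.cong ±1 p))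

        -- A partner in `σ` costs `ε ω` for moving `x` past `ω` and `ε τ` for reaching beyond `τ`.
        -- The product `ε ρ` is the same for all splittings and can be taken out of the sum.
        paired-in-τ-or-σ : ∀ ω τ → length ω ℕ.+ length τ ≡ length ρ →
          ε ω * (pf⁻ ω * pf (x ∷ τ ++ σ)) ≈
          ε ω * contract (λ y → J y ω) τ
            + ε ρ * contract (λ y σ′ → t x y * (pf⁻ ω * pf (τ ++ σ′))) σ
        paired-in-τ-or-σ ω τ p = begin
          ε ω * (pf⁻ ω * pf (x ∷ τ ++ σ))
            ≈⟨ *-congˡ (trans (*-congˡ (pfaffian-∷-++ t x τ σ)) (distribˡ _ _ _)) ⟩
          ε ω * (pf⁻ ω * contract (λ y τ′ → t x y * pf (τ′ ++ σ)) τ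
            + pf⁻ ω * (ε τ * contract (λ y σ′ → t x y * pf (τ ++ σ′)) σ))
            ≈⟨ *-congˡ (+-cong
                 (absorb ω τ)
                 (trans (x∙yz≈y∙xz _ _ _) (*-congˡ (absorb ω σ)))) ⟩
          ε ω * (contract (λ y → J y ω) τ
            + ε τ * contract (λ y σ′ → t x y * (pf⁻ ω * pf (τ ++ σ′))) σ)
            ≈⟨ distribˡ _ _ _ ⟩
          ε ω * contract (λ y → J y ω) τ
            + ε ω * (ε τ * contract (λ y σ′ → t x y * (pf⁻ ω * pf (τ ++ σ′))) σ)
            ≈⟨ +-congˡ (trans (sym (*-assoc _ _ _)) (*-congʳ (ε-ε ω τ p))) ⟩
          ε ω * contract (λ y → J y ω) τ
            + ε ρ * contract (λ y σ′ → t x y * (pf⁻ ω * pf (τ ++ σ′))) σ ∎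
          where
          absorb : ∀ ω v {g : List X → Carrier} →
            pf⁻ ω * contract (λ y v′ → t x y * g v′) v ≈
            contract (λ y v′ → t x y * (pf⁻ ω * g v′)) v
          absorb ω v = trans (sym (contract-*ˡ _ v))
            (contract-cong (λ y v′ → x∙yz≈y∙xz _ _ _) v)

      mixed-laplace : ∀ {k} (r : Vec X k) σ → length σ ≡ k →
        mixed (toList r) σ ≈ ±1 ⌊ k /2⌋ * laplace k (λ i → t (lookup r i)) σ
      mixed-laplace []                []      _ = refl
      mixed-laplace {k = suc k} (x ∷ r) σ     p = begin
        mixed (x ∷ toList r) σ
          ≈⟨ mixed-∷ x (toList r) σ ⟩
        ε (toList r) * contract (λ y σ′ → t x y * mixed (toList r) σ′) σ
          ≈⟨ *-cong (reflexive (≡.cong ±1 (length-toList r)))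
               (contract-cong-length σ (λ y σ′ q → trans
                 (*-congˡ (mixed-laplace r σ′ (ℕ.suc-injective (≡.trans (≡.sym q) p))))
                 (x∙yz≈y∙xz _ _ _))) ⟩
        ±1 k * contract (λ y σ′ → ±1 ⌊ k /2⌋ * (t x y * laplace k (λ i → t (lookup r i)) σ′)) σ
          ≈⟨ *-congˡ (contract-*ˡ _ σ) ⟩
        ±1 k * (±1 ⌊ k /2⌋ * laplace (suc k) (λ i → t (lookup (x ∷ r) i)) σ)
          ≈⟨ *-assoc _ _ _ ⟨
        (±1 k * ±1 ⌊ k /2⌋) * laplace (suc k) (λ i → t (lookup (x ∷ r) i)) σ
          ≈⟨ *-congʳ (±1-⌊/2⌋ k) ⟩
        ±1 ⌊ suc k /2⌋ * laplace (suc k) (λ i → t (lookup (x ∷ r) i)) σ ∎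

  -- Finite sums and products.

  module _ {i} {I : Set i} where

    ∑-cong-All : ∀ {xs : List I} {g h : I → Carrier} →
      All (λ x → g x ≈ h x) xs → sum-over xs g ≈ sum-over xs h
    ∑-cong-All []         = refl
    ∑-cong-All (eq ∷ eqs) = +-cong eq (∑-cong-All eqs)

    ∑-cong : ∀ {g h : I → Carrier} → (∀ x → g x ≈ h x) → ∀ xs → sum-over xs g ≈ sum-over xs h
    ∑-cong eq xs = ∑-cong-All (All.universal eq xs)

    ∑-++ : ∀ xs ys {g : I → Carrier} →
      sum-over (xs ++ ys) g ≈ sum-over xs g + sum-over ys g
    ∑-++ []       ys = sym (+-identityˡ _)
    ∑-++ (x ∷ xs) ys = trans (+-congˡ (∑-++ xs ys)) (sym (+-assoc _ _ _))

    ∑-*ˡ : ∀ a xs {g : I → Carrier} → sum-over xs (λ x → a * g x) ≈ a * sum-over xs g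
    ∑-*ˡ a []       = sym (zeroʳ a)
    ∑-*ˡ a (x ∷ xs) = trans (+-congˡ (∑-*ˡ a xs)) (sym (distribˡ a _ _))

    ∑-0 : ∀ (xs : List I) → sum-over xs (λ _ → 0#) ≈ 0#
    ∑-0 []       = refl
    ∑-0 (x ∷ xs) = trans (+-identityˡ _) (∑-0 xs)

  ∑-map : ∀ {i j} {I : Set i} {J : Set j} (h : J → I) xs {g : I → Carrier} →
    sum-over (map h xs) g ≡ sum-over xs (g ∘ h)
  ∑-map h []           = ≡.refl
  ∑-map h (x ∷ xs) {g} = ≡.cong (g (h x) +_) (∑-map h xs)

  ∏-map : ∀ {i j} {I : Set i} {J : Set j} (h : J → I) xs {g : I → Carrier} →
    product-over (map h xs) g ≡ product-over xs (g ∘ h)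
  ∏-map h []           = ≡.refl
  ∏-map h (x ∷ xs) {g} = ≡.cong (g (h x) *_) (∏-map h xs)

  ∑-concatMap : ∀ {i j} {I : Set i} {J : Set j} (h : J → List I) xs {g : I → Carrier} →
    sum-over (concatMap h xs) g ≈ sum-over xs (λ x → sum-over (h x) g)
  ∑-concatMap h []       = refl
  ∑-concatMap h (x ∷ xs) = trans (∑-++ (h x) _) (+-congˡ (∑-concatMap h xs))

  ∑-tabulate-suc : ∀ k (g : Fin (suc k) → Carrier) →
    sum-over (List.tabulate Fin.suc) g ≡ sum-over (List.allFin k) (g ∘ suc)
  ∑-tabulate-suc k g = ≡.trans
    (≡.cong (λ is → sum-over is g) (≡.sym (map-tabulate id Fin.suc)))
    (∑-map Fin.suc (List.allFin k))

  ∏-tabulate-suc : ∀ k (g : Fin (suc k) → Carrier) →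
    product-over (List.tabulate Fin.suc) g ≡ product-over (List.allFin k) (g ∘ suc)
  ∏-tabulate-suc k g = ≡.trans
    (≡.cong (λ is → product-over is g) (≡.sym (map-tabulate id Fin.suc)))
    (∏-map Fin.suc (List.allFin k))

  -- Sums over permutations and pairings as recursive expansions.

  module _ {x} {X : Set x} where

    ∑-contract : ∀ {k} (G : X → List X → Carrier) (xs : Vec X (suc k)) →
      (∑[ i ∈ List.allFin (suc k) ] ±1 (toℕ i) * G (lookup xs i) (toList (removeAt xs i)))
        ≈ contract G (toList xs)
    -- This case is separate because `removeAt` at a later index computes only once the tail is
    -- visibly nonempty.
    ∑-contract G (x ∷ [])                    = +-cong (*-identityˡ _) (sym -0#≈0#)
    ∑-contract {suc k} G (x ∷ xs@(_ ∷ _)) = +-cong (*-identityˡ _) (begin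
      (∑[ i ∈ List.tabulate Fin.suc ] ±1 (toℕ i) * G (lookup (x ∷ xs) i) (toList (removeAt (x ∷ xs) i)))
        ≡⟨ ∑-tabulate-suc (suc k) (λ i → ±1 (toℕ i) * G (lookup (x ∷ xs) i) (toList (removeAt (x ∷ xs) i))) ⟩
      (∑[ i ∈ List.allFin (suc k) ] (- 1# * ±1 (toℕ i)) * G′ (lookup xs i) (toList (removeAt xs i)))
        ≈⟨ ∑-cong (λ i → *-assoc (- 1#) (±1 (toℕ i)) _) (List.allFin (suc k)) ⟩
      (∑[ i ∈ List.allFin (suc k) ] - 1# * (±1 (toℕ i) * G′ (lookup xs i) (toList (removeAt xs i))))
        ≈⟨ ∑-*ˡ (- 1#) (List.allFin (suc k)) ⟩
      - 1# * (∑[ i ∈ List.allFin (suc k) ] ±1 (toℕ i) * G′ (lookup xs i) (toList (removeAt xs i)))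
        ≈⟨ -1*x≈-x _ ⟩
      - (∑[ i ∈ List.allFin (suc k) ] ±1 (toℕ i) * G′ (lookup xs i) (toList (removeAt xs i)))
        ≈⟨ -‿cong (∑-contract G′ xs) ⟩
      - contract G′ (toList xs) ∎)
      where
      G′ : X → List X → Carrier
      G′ y w = G y (x ∷ w)

    private
      pull-sign : ∀ k l a b {j} → j ≡ k ℕ.+ l →
        ±1 j * (a * b) ≈ (±1 k * a) * (±1 l * b)
      pull-sign k l a b ≡.refl = trans (*-congʳ (^-homo-* (- 1#) k l)) (*-interchange _ _ _ _)

    module _ {f : X → ℕ} where

      -- Putting the entry with index `i` first creates exactly `i` inversions, whatever the order
      -- of the rest. This is the sign in the expansion along the first row.
      ∑-permutations : ∀ {k} (M : Fin k → X → Carrier) (xs : Vec X k) →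
        Increasing f (toList xs) →
        (∑[ π ∈ permutations xs ]
          (±1 (inversions (map f (toList π))) * (∏[ i ∈ List.allFin k ] M i (lookup π i))))
          ≈ laplace k M (toList xs)
      ∑-permutations M []            _   = trans (+-identityʳ _) (*-identityˡ _)
      ∑-permutations {suc k} M xs@(_ ∷ _) inc = begin
        sum-over (permutations xs) term
          ≈⟨ ∑-concatMap (λ i → map (lookup xs i ∷_) (permutations (removeAt xs i))) (List.allFin _) ⟩
        (∑[ i ∈ List.allFin _ ] sum-over (map (lookup xs i ∷_) (permutations (removeAt xs i))) term)
          ≈⟨ ∑-cong first (List.allFin _) ⟩
        (∑[ i ∈ List.allFin _ ] ±1 (toℕ i) *
          (M zero (lookup xs i) * laplace k (M ∘ suc) (toList (removeAt xs i))))
          ≈⟨ ∑-contract (λ y w → M zero y * laplace k (M ∘ suc) w) xs ⟩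
        laplace (suc k) M (toList xs) ∎
        where
        ∏M : Vec X k → Carrier
        ∏M π = ∏[ j ∈ List.allFin k ] M (suc j) (lookup π j)

        term : Vec X (suc k) → Carrier
        term π = ±1 (inversions (map f (toList π))) * (∏[ j ∈ List.allFin _ ] M j (lookup π j))

        first : ∀ i → sum-over (map (lookup xs i ∷_) (permutations (removeAt xs i))) term ≈
          ±1 (toℕ i) * (M zero (lookup xs i) * laplace k (M ∘ suc) (toList (removeAt xs i)))
        first i = begin
          sum-over (map (lookup xs i ∷_) (permutations (removeAt xs i))) term
            ≡⟨ ∑-map (lookup xs i ∷_) (permutations (removeAt xs i)) ⟩
          (∑[ π ∈ permutations (removeAt xs i) ] term (lookup xs i ∷ π))
            ≈⟨ ∑-cong-All (All.map (λ {π} p → trans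
                 (*-congˡ (*-congˡ (reflexive (∏-tabulate-suc k _))))
                 (pull-sign (toℕ i) _ _ _ (inversions-lookup-∷ xs i inc p)))
                 (permutations-↭ (removeAt xs i))) ⟩
          (∑[ π ∈ permutations (removeAt xs i) ]
            (±1 (toℕ i) * M zero (lookup xs i)) * (±1 (inversions (map f (toList π))) * ∏M π))
            ≈⟨ ∑-*ˡ _ (permutations (removeAt xs i)) ⟩
          (±1 (toℕ i) * M zero (lookup xs i)) *
            (∑[ π ∈ permutations (removeAt xs i) ] ±1 (inversions (map f (toList π))) * ∏M π)
            ≈⟨ *-congˡ (∑-permutations (M ∘ suc) (removeAt xs i) (removeAt-increasing xs i inc)) ⟩
          (±1 (toℕ i) * M zero (lookup xs i)) * laplace k (M ∘ suc) (toList (removeAt xs i))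
            ≈⟨ *-assoc _ _ _ ⟩
          ±1 (toℕ i) * (M zero (lookup xs i) * laplace k (M ∘ suc) (toList (removeAt xs i))) ∎

      -- The first letter has the least number and causes no inversions; its partner, at index `i`
      -- of the tail, causes `i`. What remains is a pairing of the other letters.
      ∑-pairings : ∀ (e : X × X → Carrier) {k} (xs : Vec X k) → Increasing f (toList xs) →
        (∑[ p ∈ pairings xs ] (±1 (inversions (map f (flatten p))) * (∏[ q ∈ p ] e q)))
          ≈ pfaffian (λ y z → e (y , z)) (toList xs)
      ∑-pairings e []                  _          = trans (+-identityʳ _) (*-identityˡ _)
      ∑-pairings e (x ∷ [])            _          = refl
      ∑-pairings e (x ∷ xs@(_ ∷ _)) (x< ∷ inc) = begin
        sum-over (pairings (x ∷ xs)) term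
          ≈⟨ ∑-concatMap (λ i → map ((x , lookup xs i) ∷_) (pairings (removeAt xs i))) (List.allFin _) ⟩
        (∑[ i ∈ List.allFin _ ] sum-over (map ((x , lookup xs i) ∷_) (pairings (removeAt xs i))) term)
          ≈⟨ ∑-cong first (List.allFin _) ⟩
        (∑[ i ∈ List.allFin _ ] ±1 (toℕ i) *
          (e (x , lookup xs i) * pf (toList (removeAt xs i))))
          ≈⟨ ∑-contract (λ y w → e (x , y) * pf w) xs ⟩
        contract (λ y w → e (x , y) * pf w) (toList xs)
          ≈⟨ pfaffian-∷ _ x (toList xs) ⟨
        pf (x ∷ toList xs) ∎
        where
        pf : List X → Carrier
        pf = pfaffian (λ y z → e (y , z))

        term : List (X × X) → Carrier
        term p = ±1 (inversions (map f (flatten p))) * (∏[ q ∈ p ] e q)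

        first : ∀ i → sum-over (map ((x , lookup xs i) ∷_) (pairings (removeAt xs i))) term ≈
          ±1 (toℕ i) * (e (x , lookup xs i) * pf (toList (removeAt xs i)))
        first i = begin
          sum-over (map ((x , lookup xs i) ∷_) (pairings (removeAt xs i))) term
            ≡⟨ ∑-map ((x , lookup xs i) ∷_) (pairings (removeAt xs i)) ⟩
          (∑[ p ∈ pairings (removeAt xs i) ] term ((x , lookup xs i) ∷ p))
            ≈⟨ ∑-cong-All (All.map (λ {p} p↭ → pull-sign (toℕ i) _ _ _ (≡.trans
                 (inversions-minimum (All.map⁺ (All-resp-↭ (↭-sym (↭-trans
                   (prep (lookup xs i) p↭) (lookup-removeAt-↭ xs i))) x<)))
                 (inversions-lookup-∷ xs i inc p↭)))
                 (pairings-↭ (removeAt xs i))) ⟩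
          (∑[ p ∈ pairings (removeAt xs i) ] (±1 (toℕ i) * e (x , lookup xs i)) * term p)
            ≈⟨ ∑-*ˡ _ (pairings (removeAt xs i)) ⟩
          (±1 (toℕ i) * e (x , lookup xs i)) * sum-over (pairings (removeAt xs i)) term
            ≈⟨ *-congˡ (∑-pairings e (removeAt xs i) (removeAt-increasing xs i inc)) ⟩
          (±1 (toℕ i) * e (x , lookup xs i)) * pf (toList (removeAt xs i))
            ≈⟨ *-assoc _ _ _ ⟩
          ±1 (toℕ i) * (e (x , lookup xs i) * pf (toList (removeAt xs i))) ∎

  -- Sums over subwords of given length as sums over splittings.

  δ : ℕ → ℕ → Carrier
  δ zero    zero    = 1#
  δ zero    (suc l) = 0#
  δ (suc k) zero    = 0#
  δ (suc k) (suc l) = δ k l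

  module _ {n : ℕ} {f : Fin n → ℕ} where

    private
      unshuffle-δ-zero : ∀ {K : Word n → Word n → Carrier} w →
        unshuffle (λ ω τ → δ (length ω) 0 * K ω τ) w ≈ K [] w
      unshuffle-δ-zero     []      = *-identityˡ _
      unshuffle-δ-zero {K} (x ∷ w) = begin
        _ ≈⟨ +-cong (trans (unshuffle-cong (λ _ _ → zeroˡ _) w) (unshuffle-0 w))
               (trans (unshuffle-cong (λ ω τ → x∙yz≈y∙xz _ _ _) w) (unshuffle-δ-zero w)) ⟩
        0# + 1# * K [] (x ∷ w)
          ≈⟨ trans (+-identityˡ _) (*-identityˡ _) ⟩
        K [] (x ∷ w) ∎

    increasing⇒≢ : ∀ {x : Fin n} {w} → All (λ y → f x < f y) w → All (x ≢_) w
    increasing⇒≢ = All.map (λ fx<fy x≡y → ℕ.<⇒≢ fx<fy (≡.cong f x≡y))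

    -- The Kronecker delta selects the splittings with `ω` of length `l`. The first letter has the
    -- least number: in `ω` it comes first and causes no inversions, outside `ω` it is inverted with
    -- every letter of `ω`. These are the signs built into `unshuffle`.
    ∑-subwords : ∀ l (K : Word n → Word n → Carrier) w → Increasing f w →
      (∑[ ω ∈ subwords l w ] (±1 (inversions (map f (ω ++ (w ∖ ω)))) * K ω (w ∖ ω)))
        ≈ unshuffle (λ ω τ → δ (length ω) l * K ω τ) w
    ∑-subwords zero K w inc = begin
      ±1 (inversions (map f (w ∖ []))) * K [] (w ∖ []) + 0#
        ≡⟨ ≡.cong (λ v → ±1 (inversions (map f v)) * K [] v + 0#) (∖-[] w) ⟩
      ±1 (inversions (map f w)) * K [] w + 0#
        ≡⟨ ≡.cong (λ i → ±1 i * K [] w + 0#) (inversions-increasing w inc) ⟩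
      1# * K [] w + 0#
        ≈⟨ trans (+-identityʳ _) (*-identityˡ _) ⟩
      K [] w
        ≈⟨ unshuffle-δ-zero w ⟨
      unshuffle (λ ω τ → δ (length ω) 0 * K ω τ) w ∎
    ∑-subwords (suc l) K []      _          = sym (zeroˡ _)
    ∑-subwords (suc l) K (x ∷ w) (x< ∷ inc) = begin
      sum-over (map (x ∷_) (subwords l w) ++ subwords (suc l) w) term
        ≈⟨ ∑-++ (map (x ∷_) (subwords l w)) (subwords (suc l) w) ⟩
      sum-over (map (x ∷_) (subwords l w)) term + sum-over (subwords (suc l) w) term
        ≈⟨ +-cong
             (trans (reflexive (∑-map (x ∷_) (subwords l w)))
               (∑-cong-All (All.map with-x (subwords-All l x<))))
             (∑-cong-All (All.map without-x (subwords-All (suc l) x<))) ⟩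
      (∑[ ω ∈ subwords l w ] ±1 (inversions (map f (ω ++ (w ∖ ω)))) * K (x ∷ ω) (w ∖ ω))
        + (∑[ ω ∈ subwords (suc l) w ]
            ±1 (inversions (map f (ω ++ (w ∖ ω)))) * (ε ω * K ω (x ∷ w ∖ ω)))
        ≈⟨ +-cong
             (∑-subwords l (λ ω → K (x ∷ ω)) w inc)
             (trans (∑-subwords (suc l) (λ ω τ → ε ω * K ω (x ∷ τ)) w inc)
               (unshuffle-cong (λ ω τ → x∙yz≈y∙xz _ _ _) w)) ⟩
      unshuffle (λ ω τ → δ (length ω) (suc l) * K ω τ) (x ∷ w) ∎
      where
      term : Word n → Carrier
      term ω = ±1 (inversions (map f (ω ++ ((x ∷ w) ∖ ω)))) * K ω ((x ∷ w) ∖ ω)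

      x<∖ : ∀ ω → All (λ y → f x < f y) (w ∖ ω)
      x<∖ ω = All.filter⁺ (λ y → ¬? (_∈?_ _≟_ y ω)) x<

      with-x : ∀ {ω} → All (λ y → f x < f y) ω →
        term (x ∷ ω) ≈ ±1 (inversions (map f (ω ++ (w ∖ ω)))) * K (x ∷ ω) (w ∖ ω)
      with-x {ω} x<ω rewrite ∖-∷-∷ ω (increasing⇒≢ x<) = *-congʳ (reflexive (≡.cong ±1
        (inversions-minimum (All.map⁺ (All.++⁺ x<ω (x<∖ ω))))))

      without-x : ∀ {ω} → All (λ y → f x < f y) ω →
        term ω ≈ ±1 (inversions (map f (ω ++ (w ∖ ω)))) * (ε ω * K ω (x ∷ w ∖ ω))
      without-x {ω} x<ω rewrite ∖-∷ w (increasing⇒≢ x<ω) = begin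
        ±1 (inversions (map f (ω ++ x ∷ w ∖ ω))) * K ω (x ∷ w ∖ ω)
          ≡⟨ ≡.cong (λ i → ±1 i * K ω (x ∷ w ∖ ω)) sign ⟩
        ±1 (length ω ℕ.+ inversions (map f (ω ++ (w ∖ ω)))) * K ω (x ∷ w ∖ ω)
          ≈⟨ *-congʳ (trans (^-homo-* (- 1#) (length ω) _) (*-comm _ _)) ⟩
        (±1 (inversions (map f (ω ++ (w ∖ ω)))) * ε ω) * K ω (x ∷ w ∖ ω)
          ≈⟨ *-assoc _ _ _ ⟩
        ±1 (inversions (map f (ω ++ (w ∖ ω)))) * (ε ω * K ω (x ∷ w ∖ ω)) ∎
        where
        sign : inversions (map f (ω ++ x ∷ w ∖ ω)) ≡ length ω ℕ.+ inversions (map f (ω ++ (w ∖ ω)))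
        sign rewrite map-++ f ω (x ∷ w ∖ ω) | map-++ f ω (w ∖ ω) = ≡.trans
          (inversions-insert (map f ω) (map f (w ∖ ω)) (All.map⁺ x<ω) (All.map⁺ (x<∖ ω)))
          (≡.cong (ℕ._+ inversions (map f ω ++ map f (w ∖ ω))) (length-map f ω))

  -- Parity

  even : ℕ → Carrier
  even zero          = 1#
  even (suc zero)    = 0#
  even (suc (suc l)) = even l

  δ-suc-double : ∀ l k → δ (suc (suc l)) (2 ℕ.* suc k) ≡ δ l (2 ℕ.* k)
  δ-suc-double l k = ≡.cong (δ (suc (suc l))) (ℕ.*-suc 2 k)

  δ-one-double : ∀ k → δ 1 (2 ℕ.* k) ≡ 0#
  δ-one-double zero    = ≡.refl
  δ-one-double (suc k) = ≡.cong (δ 1) (ℕ.*-suc 2 k)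

  -- Where the delta does not vanish, `k` is half of `l`. The sign then depends only on the length
  -- of `ω`, as in `pfaffian-neg`.
  δ-double-sign : ∀ l k → δ l (2 ℕ.* k) * ±1 k ≈ δ l (2 ℕ.* k) * ±1 ⌊ l /2⌋
  δ-double-sign zero          zero    = refl
  δ-double-sign zero          (suc k) = trans (zeroˡ _) (sym (zeroˡ _))
  δ-double-sign (suc zero)    k       rewrite δ-one-double k = trans (zeroˡ _) (sym (zeroˡ _))
  δ-double-sign (suc (suc l)) zero    = trans (zeroˡ _) (sym (zeroˡ _))
  δ-double-sign (suc (suc l)) (suc k) = begin
    δ (suc (suc l)) (2 ℕ.* suc k) * (- 1# * ±1 k)
      ≈⟨ trans (*-congʳ (reflexive (δ-suc-double l k))) (x∙yz≈y∙xz _ _ _) ⟩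
    - 1# * (δ l (2 ℕ.* k) * ±1 k)
      ≈⟨ *-congˡ (δ-double-sign l k) ⟩
    - 1# * (δ l (2 ℕ.* k) * ±1 ⌊ l /2⌋)
      ≈⟨ trans (x∙yz≈y∙xz _ _ _) (*-congʳ (reflexive (≡.sym (δ-suc-double l k)))) ⟩
    δ (suc (suc l)) (2 ℕ.* suc k) * (- 1# * ±1 ⌊ l /2⌋) ∎

  ∑-upTo-suc : ∀ h (g : ℕ → Carrier) →
    sum-over (upTo (suc h)) g ≡ g 0 + sum-over (upTo h) (g ∘ suc)
  ∑-upTo-suc h g = ≡.cong (g 0 +_) (≡.trans
    (≡.cong (λ ks → sum-over ks g) (≡.sym (map-upTo suc h))) (∑-map suc (upTo h)))

  -- An even `l` is hit by exactly one `k`, which the bound keeps in range; an odd `l` is hit by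
  -- none. Dropping the term at 0 and shifting the index lowers `l` by 2 and `h` by 1.
  ∑-δ-double : ∀ l h → ⌊ l /2⌋ ≤ h → (∑[ k ∈ upTo (suc h) ] δ l (2 ℕ.* k)) ≈ even l
  ∑-δ-double l h l/2≤h =
    trans (reflexive (∑-upTo-suc h (λ k → δ l (2 ℕ.* k)))) (first l h l/2≤h)
    where
    first : ∀ l h → ⌊ l /2⌋ ≤ h →
      δ l 0 + (∑[ k ∈ upTo h ] δ l (2 ℕ.* suc k)) ≈ even l
    first zero          h       _         = trans (+-congˡ (∑-0 (upTo h))) (+-identityʳ 1#)
    first (suc zero)    h       _         = trans (+-identityˡ _)
      (trans (∑-cong (λ k → reflexive (δ-one-double (suc k))) (upTo h)) (∑-0 (upTo h)))
    first (suc (suc l)) (suc h) (s≤s l/2≤h) = trans (+-identityˡ _)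
      (trans (∑-cong (λ k → reflexive (δ-suc-double l k)) (upTo (suc h)))
        (∑-δ-double l h l/2≤h))

  module _ {x} {X : Set x} where

    ∑-unshuffle : ∀ {i} {I : Set i} (is : List I) {K : I → List X → List X → Carrier} w →
      (∑[ j ∈ is ] unshuffle (K j) w) ≈ unshuffle (λ ω τ → ∑[ j ∈ is ] K j ω τ) w
    ∑-unshuffle []       w = sym (unshuffle-0 w)
    ∑-unshuffle (j ∷ is) w = trans (+-congˡ (∑-unshuffle is w)) (sym (unshuffle-+ w))

    laplace-map : ∀ {y} {Y : Set y} (h : Y → X) k (M : Fin k → X → Carrier) w →
      laplace k M (map h w) ≈ laplace k (λ i y → M i (h y)) w
    laplace-map h zero    M w = refl
    laplace-map h (suc k) M w = trans (reflexive (contract-map h _ w))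
      (contract-cong (λ y w′ → *-congˡ (laplace-map h k (M ∘ suc) w′)) w)

    module _ (t : X → X → Carrier) where

      -- Odd words have Pfaffian 0. As a factor, this absorbs the parity left by the sum over `k`
      -- without a case distinction.
      pfaffian-even : ∀ w → even (length w) * pfaffian t w ≈ pfaffian t w
      pfaffian-even w = within (length w) w
        where
        within : ∀ f w → even (length w) * pfaffianWithin t f w ≈ pfaffianWithin t f w
        within f       []      = *-identityˡ _
        within zero    (x ∷ w) = zeroʳ _
        within (suc f) (x ∷ w) = trans (sym (contract-*ˡ _ w))
          (contract-cong-length w (λ y w′ p → trans
            (*-congʳ (reflexive (≡.cong (even ∘ suc) p)))
            (trans (x∙yz≈y∙xz _ _ _) (*-congˡ (within f w′)))))

      -- Each pair contributes one sign, and there are `⌊ length w /2⌋` pairs; for odd length both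
      -- sides are 0.
      pfaffian-neg : ∀ w →
        pfaffian (λ x y → - t x y) w ≈ ±1 ⌊ length w /2⌋ * pfaffian t w
      pfaffian-neg w = within (length w) w
        where
        within : ∀ f w → pfaffianWithin (λ x y → - t x y) f w ≈
          ±1 ⌊ length w /2⌋ * pfaffianWithin t f w
        within f       []      = sym (*-identityˡ _)
        within zero    (x ∷ w) = sym (zeroʳ _)
        within (suc f) (x ∷ w) = trans
          (contract-cong-length w (λ y w′ p → begin
            - t x y * pfaffianWithin (λ x y → - t x y) f w′
              ≈⟨ *-cong (sym (-1*x≈-x _)) (within f w′) ⟩
            (- 1# * t x y) * (±1 ⌊ length w′ /2⌋ * pfaffianWithin t f w′)
              ≈⟨ *-interchange _ _ _ _ ⟩
            ±1 ⌊ suc (suc (length w′)) /2⌋ * (t x y * pfaffianWithin t f w′)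
              ≡⟨ ≡.cong (λ l → ±1 ⌊ suc l /2⌋ * (t x y * pfaffianWithin t f w′)) p ⟨
            ±1 ⌊ suc (length w) /2⌋ * (t x y * pfaffianWithin t f w′) ∎))
          (contract-*ˡ _ w)

  -- Assembling the determinant identity.

  det-laplace : ∀ {n m} (T : Matrix n n) (r s : Vec (Fin n) m) →
    det (submatrix T r s) ≈ laplace m (λ i → T (lookup r i)) (toList s)
  det-laplace {m = m} T r s = begin
    det (submatrix T r s)
      ≈⟨ ∑-permutations (submatrix T r s) (Vec.allFin m)
           (≡.subst (Increasing (position (List.allFin m))) (≡.sym (toList-allFin m))
             (position-increasing (List.allFin m) (allFin⁺ m))) ⟩
    laplace m (submatrix T r s) (toList (Vec.allFin m))
      -- The permutations in `det` arrange column numbers; `lookup s` renames these to the letters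
      -- of `s`.
      ≈⟨ laplace-map (lookup s) m (λ i → T (lookup r i)) (toList (Vec.allFin m)) ⟨
    laplace m (λ i → T (lookup r i)) (map (lookup s) (toList (Vec.allFin m)))
      ≡⟨ ≡.cong (laplace m (λ i → T (lookup r i))) (≡.trans
           (≡.sym (toList-map (lookup s) (Vec.allFin m)))
           (≡.cong toList (map-lookup-allFin s))) ⟩
    laplace m (λ i → T (lookup r i)) (toList s) ∎

  module _ {n : ℕ} (T : Matrix n n)
    (skew : ∀ i j → T j i ≈ - T i j) (alt : ∀ i → T i i ≈ 0#) where

    private
      pf pf⁻ : Word n → Carrier
      pf  = pfaffian T
      pf⁻ = pfaffian (λ i j → - T i j)

    -- For distinct letters `position w` is an increasing numbering and `∑-pairings` applies.
    -- Repetitions do occur, when `τ` and `σ` share a letter; then both sides vanish.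
    𝒫-pfaffian : ∀ w → 𝒫 T w ≈ pf w
    𝒫-pfaffian w with unique? _≟_ w
    ... | yes uniq = trans
      (∑-pairings _ (Vec.fromList w) (≡.subst (Increasing (position w)) (≡.sym (toList∘fromList w))
        (position-increasing w uniq)))
      (reflexive (≡.cong pf (toList∘fromList w)))
    ... | no ¬uniq with u , x , v , v′ , ≡.refl ← repeated-letter w ¬uniq =
      sym (Alternating.pfaffian-repeat T skew alt u x v v′)

    -- On words of length `2k` the sign (-1)ᵏ turns `pf` into `pf⁻`, so each `k` gives the part of
    -- `mixed` with `ω` of that length.
    ∑-subwords-double : ∀ k ρ σ → Unique ρ →
      ±1 k * (∑[ ω ∈ subwords (2 ℕ.* k) ρ ]
        (sgn ρ (ω ++ (ρ ∖ ω)) * 𝒫 T ω * 𝒫 T ((ρ ∖ ω) ++ σ)))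
        ≈ unshuffle (λ ω τ → δ (length ω) (2 ℕ.* k) * (pf⁻ ω * pf (τ ++ σ))) ρ
    ∑-subwords-double k ρ σ uniq = begin
      ±1 k * (∑[ ω ∈ subwords (2 ℕ.* k) ρ ]
        (sgn ρ (ω ++ (ρ ∖ ω)) * 𝒫 T ω * 𝒫 T ((ρ ∖ ω) ++ σ)))
        ≈⟨ *-congˡ (∑-cong (λ ω → trans (*-assoc _ _ _)
             (*-congˡ (*-cong (𝒫-pfaffian ω) (𝒫-pfaffian ((ρ ∖ ω) ++ σ)))))
             (subwords (2 ℕ.* k) ρ)) ⟩
      ±1 k * (∑[ ω ∈ subwords (2 ℕ.* k) ρ ]
        (sgn ρ (ω ++ (ρ ∖ ω)) * (pf ω * pf ((ρ ∖ ω) ++ σ))))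
        ≈⟨ *-congˡ (∑-subwords (2 ℕ.* k) (λ ω τ → pf ω * pf (τ ++ σ)) ρ
             (position-increasing ρ uniq)) ⟩
      ±1 k * unshuffle (λ ω τ → δ (length ω) (2 ℕ.* k) * (pf ω * pf (τ ++ σ))) ρ
        ≈⟨ unshuffle-*ˡ _ ρ ⟨
      unshuffle (λ ω τ → ±1 k * (δ (length ω) (2 ℕ.* k) * (pf ω * pf (τ ++ σ)))) ρ
        ≈⟨ unshuffle-cong (λ ω τ → negate ω (pf (τ ++ σ))) ρ ⟩
      unshuffle (λ ω τ → δ (length ω) (2 ℕ.* k) * (pf⁻ ω * pf (τ ++ σ))) ρ ∎
      where
      negate : ∀ ω a → ±1 k * (δ (length ω) (2 ℕ.* k) * (pf ω * a)) ≈
        δ (length ω) (2 ℕ.* k) * (pf⁻ ω * a)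
      negate ω a = begin
        ±1 k * (δ l (2 ℕ.* k) * (pf ω * a))
          ≈⟨ *-assoc _ _ _ ⟨
        (±1 k * δ l (2 ℕ.* k)) * (pf ω * a)
          ≈⟨ *-congʳ (trans (*-comm _ _) (δ-double-sign l k)) ⟩
        (δ l (2 ℕ.* k) * ±1 ⌊ l /2⌋) * (pf ω * a)
          ≈⟨ trans (*-assoc _ _ _) (*-congˡ (sym (*-assoc _ _ _))) ⟩
        δ l (2 ℕ.* k) * ((±1 ⌊ l /2⌋ * pf ω) * a)
          ≈⟨ *-congˡ (*-congʳ (pfaffian-neg T ω)) ⟨
        δ l (2 ℕ.* k) * (pf⁻ ω * a) ∎
        where
        l : ℕ
        l = length ω

    ∑-∑-subwords : ∀ {m} ρ σ → length ρ ≡ m → Unique ρ →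
      (∑[ k ∈ upTo (suc ⌊ m /2⌋) ]
        (±1 k * (∑[ ω ∈ subwords (2 ℕ.* k) ρ ]
          (sgn ρ (ω ++ (ρ ∖ ω)) * 𝒫 T ω * 𝒫 T ((ρ ∖ ω) ++ σ)))))
        ≈ mixed T ρ σ
    ∑-∑-subwords ρ σ ≡.refl uniq = begin
      _ ≈⟨ ∑-cong (λ k → ∑-subwords-double k ρ σ uniq) ks ⟩
      (∑[ k ∈ ks ] unshuffle (λ ω τ → δ (length ω) (2 ℕ.* k) * (pf⁻ ω * pf (τ ++ σ))) ρ)
        ≈⟨ ∑-unshuffle ks ρ ⟩
      unshuffle (λ ω τ → ∑[ k ∈ ks ] δ (length ω) (2 ℕ.* k) * (pf⁻ ω * pf (τ ++ σ))) ρ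
        ≈⟨ unshuffle-cong-length ρ collect ⟩
      mixed T ρ σ ∎
      where
      ks : List ℕ
      ks = upTo (suc ⌊ length ρ /2⌋)

      collect : ∀ ω τ → length ω ℕ.+ length τ ≡ length ρ →
        (∑[ k ∈ ks ] δ (length ω) (2 ℕ.* k) * (pf⁻ ω * pf (τ ++ σ))) ≈ pf⁻ ω * pf (τ ++ σ)
      collect ω τ p = begin
        (∑[ k ∈ ks ] δ (length ω) (2 ℕ.* k) * (pf⁻ ω * pf (τ ++ σ)))
          ≈⟨ ∑-cong (λ k → *-comm _ _) ks ⟩
        (∑[ k ∈ ks ] (pf⁻ ω * pf (τ ++ σ)) * δ (length ω) (2 ℕ.* k))
          ≈⟨ trans (∑-*ˡ _ ks) (*-comm _ _) ⟩
        (∑[ k ∈ ks ] δ (length ω) (2 ℕ.* k)) * (pf⁻ ω * pf (τ ++ σ))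
          -- As a part of `ρ`, `ω` is no longer than `ρ`, so half its length is within the range of
          -- `k`.
          ≈⟨ *-congʳ (∑-δ-double (length ω) _
               (ℕ.⌊n/2⌋-mono (ℕ.m+n≤o⇒m≤o (length ω) (ℕ.≤-reflexive p)))) ⟩
        even (length ω) * (pf⁻ ω * pf (τ ++ σ))
          ≈⟨ *-assoc _ _ _ ⟨
        (even (length ω) * pf⁻ ω) * pf (τ ++ σ)
          ≈⟨ *-congʳ (pfaffian-even _ ω) ⟩
        pf⁻ ω * pf (τ ++ σ) ∎

    det-expansion : ∀ {m} (r s : Vec (Fin n) m) → Unique (toList r) →
      det (submatrix T r s)
        ≈ ±1 ⌊ m /2⌋ *
          (∑[ k ∈ upTo (suc ⌊ m /2⌋) ]
            (±1 k *
              (∑[ ω ∈ subwords (2 ℕ.* k) (toList r) ]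
                (sgn (toList r) (ω ++ (toList r ∖ ω)) * 𝒫 T ω * 𝒫 T ((toList r ∖ ω) ++ toList s)))))
    det-expansion {m} r s uniq = begin
      det (submatrix T r s)
        ≈⟨ det-laplace T r s ⟩
      laplace m (λ i → T (lookup r i)) (toList s)
        -- The sign is its own inverse; inserting it twice moves it from the Laplace side of
        -- `mixed-laplace` to the side of the mixed sum.
        ≈⟨ ±1-cancelˡ ⌊ m /2⌋ _ ⟨
      ±1 ⌊ m /2⌋ * (±1 ⌊ m /2⌋ * laplace m (λ i → T (lookup r i)) (toList s))
        ≈⟨ *-congˡ (mixed-laplace T r (toList s) (length-toList s)) ⟨
      ±1 ⌊ m /2⌋ * mixed T (toList r) (toList s)
        ≈⟨ *-congˡ (∑-∑-subwords (toList r) (toList s) (length-toList r) uniq) ⟨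
      _ ∎

increasing-unique : ∀ {n m} (R : Subset n) (∣R∣≡m : ∣ R ∣ ≡ m) →
  Unique (toList (increasing R ∣R∣≡m))
increasing-unique R ∣R∣≡m = ≡.subst Unique (≡.sym (toList-cast ∣R∣≡m (elements R))) (elements-unique R)

theorem1 :
    ∀ {c ℓ} (A : CommutativeRing c ℓ) →
    let open CommutativeRing A
        open Pfaffians A
    in
    (n : ℕ) → 1 ≤ n →
    (T : Matrix n n) →
    (∀ i j → T j i ≈ - T i j) →
    (∀ i → T i i ≈ 0#) →
    (m : ℕ) (R S : Subset n) (∣R∣≡m : ∣ R ∣ ≡ m) (∣S∣≡m : ∣ S ∣ ≡ m) →
    let r = increasing R ∣R∣≡m
        s = increasing S ∣S∣≡m
        ρ = toList r
        σ = toList s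
    in
    det (submatrix T r s)
      ≈ (- 1#) ^ ⌊ m /2⌋ *
        (∑[ k ∈ upTo (suc ⌊ m /2⌋) ]
          ((- 1#) ^ k *
            (∑[ ω ∈ subwords (2 ℕ.* k) ρ ]
              (sgn ρ (ω ++ (ρ ∖ ω)) * 𝒫 T ω * 𝒫 T ((ρ ∖ ω) ++ σ)))))
theorem1 A n _ T skew alt m R S ∣R∣≡m ∣S∣≡m =
  Expansion.det-expansion A T skew alt (increasing R ∣R∣≡m) (increasing S ∣S∣≡m)
    (increasing-unique R ∣R∣≡m)
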